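{- Let $C,\epsilon>0$ be real numbers and let $t\in\mathbb{N}$. Let $n(C,\epsilon,3^t)$ be the minimal $n\in\mathbb{N}$ such that for every $C$-Lipschitz function $f:PS_{\ell_\infty^n}\to\mathbb{R}$ there is a positive block sequence $(\mathbf{y}_i)_{i<3^t}$ in $\ell_\infty^n$ with $$\mathrm{osc}\bigl(f\upharpoonright PS_{[\mathbf{y}_i]_{i<3^t}}\bigr)<\epsilon.$$ Then $$n(C,\epsilon,3^t)<f_3\left(3^{t\cdot s}\left\lceil\frac{9C}{\epsilon}\right\rceil^{3^{t\cdot s}}\left\lceil\log_2\frac{9}{\epsilon}\right\rceil\right),\qquad\text{where } s=\left\lceil\frac{\log(\epsilon/12C)}{\log(1-\epsilon/12C)}\right\rceil+2 .$$
   Context: $\epsilon/12C$ means $\epsilon/(12C)$. $\mathbb{N}$ starts at $0$. The function $f_3:\mathbb{N}\to\mathbb{N}$ (TOWER) is the third function of the Ackermann hierarchy: $f_1(x)=2x$ and $f_{i+1}(x)=f_i^{(x)}(1)$, where $f_i^{(x)}$ is the $x$-fold iterate of $f_i$. $\ell_\infty^n$ is $\mathbb{R}^n$ with the sup norm and its standard basis $(\mathbf{e}_i)_{i<n}$. The support of $\mathbf{x}=\sum_{i<n}a_i\mathbf{e}_i$ is $\mathrm{supp}(\mathbf{x})=\{i<n:a_i\ne 0\}$, and $\mathbf{x}$ is positive if every $a_i\ge 0$. A positive block sequence $(\mathbf{y}_i)_{i<m}$ is a sequence of nonzero positive vectors with $\max\mathrm{supp}(\mathbf{y}_i)<\min\mathrm{supp}(\mathbf{y}_j)$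 for all $i<j<m$. $[\mathbf{y}_i]_{i<m}$ denotes the linear span of $(\mathbf{y}_i)_{i<m}$. For a subspace $Y$ of $\ell_\infty^n$ generated by a positive block sequence (including $Y=\ell_\infty^n$ itself), $PS_Y$ is the positive unit sphere of $Y$, i.e. the set of positive vectors of norm $1$ in $Y$. $C$-Lipschitz is with respect to the sup norm. For a real-valued function $f$ and a subset $A$ of its domain, $\mathrm{osc}(f\upharpoonright A)=\sup\{|f(\mathbf{x})-f(\mathbf{y})|:\mathbf{x},\mathbf{y}\in A\}$.
   Formalization: The formal theorem assumes ε < 12C, so that s is defined, and ε < 9: for 9 ≤ ε < 18 the last ceiling is 0 and the bound would read n < f₃(0) = 1, which is false, and for ε ≥ 18 the argument of f₃ is negative. -}

module Defs where

open import Algebra.Bundles using (CommutativeRing)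
open import Data.Fin.Base as Fin using (Fin)
open import Data.Nat.Base as ℕ using (ℕ; zero; suc)
open import Data.Nat.GeneralisedArithmetic using (fold)
open import Data.Product.Base using (_×_; ∃; ∃₂; proj₁)
open import Data.Vec.Functional using (Vector; foldr; map; zipWith)
open import Level using (0ℓ) renaming (suc to lsuc)
open import Relation.Binary.Bundles using (TotalOrder)
open import Relation.Binary.Core using (Rel)
open import Relation.Binary.Structures using (IsTotalOrder)
open import Relation.Nullary.Negation.Core using (¬_)
open import Relation.Unary using (Pred; _∈_; U)
import Algebra.Construct.NaturalChoice.Max as Max
import Algebra.Definitions.RawMonoid as RawMonoidDefinitions
import Relation.Binary.Construct.NonStrictToStrict as ToStrict

-- The Ackermann hierarchy, shifted by one: hierarchy i is f_{i+1}.
hierarchy : ℕ → ℕ → ℕ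
hierarchy zero    x = 2 ℕ.* x
hierarchy (suc i) x = fold 1 (hierarchy i) x

f₃ : ℕ → ℕ
f₃ = hierarchy 2

Minimal : Pred ℕ 0ℓ → Pred ℕ 0ℓ
Minimal P n = P n × (∀ k → P k → n ℕ.≤ k)

-- The real numbers, given by the axioms of a Dedekind-complete ordered field,
-- which determine ℝ up to unique isomorphism.  The value of the inverse at 0 is
-- unspecified.
record Reals : Set (lsuc 0ℓ) where
  field
    commutativeRing : CommutativeRing 0ℓ 0ℓ

  open CommutativeRing commutativeRing public
    renaming (Carrier to ℝ)

  infix  8 _⁻¹
  infix  4 _≤_

  field
    _⁻¹          : ℝ → ℝ
    *-inverseʳ   : ∀ x → ¬ (x ≈ 0#) → x * x ⁻¹ ≈ 1#
    0≉1          : ¬ (0# ≈ 1#)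
    _≤_          : Rel ℝ 0ℓ
    isTotalOrder : IsTotalOrder _≈_ _≤_
    +-monoʳ-≤    : ∀ x {y z} → y ≤ z → x + y ≤ x + z
    *-nonNeg     : ∀ {x y} → 0# ≤ x → 0# ≤ y → 0# ≤ x * y

  UpperBound : Pred ℝ 0ℓ → Pred ℝ 0ℓ
  UpperBound A b = ∀ x → x ∈ A → x ≤ b

  IsSup : Pred ℝ 0ℓ → Pred ℝ 0ℓ
  IsSup A u = UpperBound A u × (∀ b → UpperBound A b → u ≤ b)

  field
    complete : ∀ (A : Pred ℝ 0ℓ) → ∃ A → ∃ (UpperBound A) → ∃ (IsSup A)

  totalOrder : TotalOrder 0ℓ 0ℓ 0ℓ
  totalOrder = record { isTotalOrder = isTotalOrder }

  open ToStrict _≈_ _≤_ public using (_<_)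
  open Max totalOrder public using (_⊔_)
  open RawMonoidDefinitions +-rawMonoid public using (sum)

  infixl 7 _÷_

  _÷_ : ℝ → ℝ → ℝ
  x ÷ y = x * y ⁻¹

  fromℕ : ℕ → ℝ
  fromℕ n = RawMonoidDefinitions._×_ +-rawMonoid n 1#

  ∣_∣ : ℝ → ℝ
  ∣ x ∣ = x ⊔ (- x)

  ⌈_⌉≡_ : ℝ → ℕ → Set
  ⌈ x ⌉≡ k = x ≤ fromℕ k × fromℕ k < x + 1#

  -- The strictly increasing solutions of log (xy) = log x + log y on the
  -- positive reals are exactly the logarithms to the bases b > 1; a quotient
  -- log x ÷ log y is the same for all of them.
  record IsLogarithm (log : ℝ → ℝ) : Set where
    field
      log-cong : ∀ {x y} → 0# < x → x ≈ y → log x ≈ log y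
      log-*    : ∀ {x y} → 0# < x → 0# < y → log (x * y) ≈ log x + log y
      log-mono : ∀ {x y} → 0# < x → x < y → log x < log y

  ‖_‖ : ∀ {n} → Vector ℝ n → ℝ
  ‖ x ‖ = foldr _⊔_ 0# (map ∣_∣ x)

  _⊖_ : ∀ {n} → Vector ℝ n → Vector ℝ n → Vector ℝ n
  _⊖_ = zipWith _-_

  supp : ∀ {n} → Vector ℝ n → Pred (Fin n) 0ℓ
  supp x i = ¬ (x i ≈ 0#)

  Nonzero : ∀ {n} → Pred (Vector ℝ n) 0ℓ
  Nonzero x = ¬ (∀ i → x i ≈ 0#)

  Positive : ∀ {n} → Pred (Vector ℝ n) 0ℓ
  Positive x = ∀ i → 0# ≤ x i

  IsMax IsMin : ∀ {n} → Pred (Fin n) 0ℓ → Pred (Fin n) 0ℓ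
  IsMax A i = i ∈ A × (∀ j → j ∈ A → j Fin.≤ i)
  IsMin A i = i ∈ A × (∀ j → j ∈ A → i Fin.≤ j)

  record IsPositiveBlockSequence {m n} (y : Vector (Vector ℝ n) m) : Set where
    field
      nonzero  : ∀ i → Nonzero (y i)
      positive : ∀ i → Positive (y i)
      block    : ∀ i j → i Fin.< j → ∃₂ λ a b →
                 IsMax (supp (y i)) a × IsMin (supp (y j)) b × a Fin.< b

  Span : ∀ {m n} → Vector (Vector ℝ n) m → Pred (Vector ℝ n) 0ℓ
  Span {m} y x = ∃ λ (c : Vector ℝ m) → ∀ j → x j ≈ sum (λ i → c i * y i j)

  PS : ∀ {n} → Pred (Vector ℝ n) 0ℓ → Pred (Vector ℝ n) 0ℓ
  PS Y x = x ∈ Y × Positive x × ‖ x ‖ ≈ 1#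

  ℓ∞ : ∀ n → Pred (Vector ℝ n) 0ℓ
  ℓ∞ n = U

  -- A real function on the subset D of ℓ∞ⁿ is a function on ∃ D.  It is not
  -- assumed to respect ≈ or to ignore the membership proof; both follow from
  -- the Lipschitz condition.
  Lipschitz : ∀ {n} {D : Pred (Vector ℝ n) 0ℓ} → ℝ → (∃ D → ℝ) → Set
  Lipschitz C f = ∀ p q → ∣ f p - f q ∣ ≤ C * ‖ proj₁ p ⊖ proj₁ q ‖

  IsOsc : ∀ {n} {D : Pred (Vector ℝ n) 0ℓ} →
          (∃ D → ℝ) → Pred (Vector ℝ n) 0ℓ → Pred ℝ 0ℓ
  IsOsc f A = IsSup λ r → ∃₂ λ p q →
    proj₁ p ∈ A × proj₁ q ∈ A × r ≈ ∣ f p - f q ∣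

  Stabilizes : ℝ → ℝ → ℕ → Pred ℕ 0ℓ
  Stabilizes C ε m n =
    ∀ (f : ∃ (PS (ℓ∞ n)) → ℝ) → Lipschitz C f →
    ∃ λ (y : Vector (Vector ℝ n) m) → IsPositiveBlockSequence y ×
      (∃ λ o → IsOsc f (PS (Span y)) o × o < ε)

{-# OPTIONS --safe #-}
module Submission where

-- Put q = 1 - δ, so q ^ r ≤ δ.  A word over ℕ stands for the vector whose entries are q ^ a
-- for the letters a of the word.  By Ramsey's theorem, f is nearly constant on the copies of
-- one fixed word, the target, placed on subsets of a large set H of positions.  The yᵢ are
-- copies of a longer word, the block, on consecutive pieces of H.  A unit vector of their
-- span is described by shifted blocks side by side, and it is within 2δ of a copy of the
-- target on some subset of H: words are nested (letters ℓ separate words with larger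
-- letters), and two such words with different numbers of letters ℓ still match up to one
-- level, since any surplus of letters ℓ on one side can be matched with letters ℓ + 1 inside
-- a single gap of the other side.
-- The Ramsey numbers needed are towers whose height is linear in the length of the target,
-- far less than the height allowed.

open import Axiom.ExcludedMiddle using (ExcludedMiddle)
open import Data.Empty using (⊥; ⊥-elim)
open import Data.Fin.Base as Fin using (Fin)
import Data.Fin.Properties as Fin
open import Data.List.Base as List using (List; []; _∷_; _++_; length)
open import Data.List.Membership.Propositional using (_∈_)
open import Data.List.Membership.Propositional.Properties using (∈-++⁺ʳ; ∈-tabulate⁺; ∈-map⁺)
import Data.List.Properties as List
open import Data.List.Relation.Binary.Pointwise as Pointwise using (Pointwise; []; _∷_)
open import Data.List.Relation.Binary.Sublist.Propositional using (_⊆_; []; _∷_; _∷ʳ_; ⊆-trans)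
open import Data.List.Relation.Binary.Sublist.Propositional.Properties
  using (All-resp-⊆; take-⊆)
open import Data.List.Relation.Unary.All as All using (All; []; _∷_)
import Data.List.Relation.Unary.All.Properties as All
open import Data.List.Relation.Unary.AllPairs using (AllPairs; []; _∷_)
import Data.List.Relation.Unary.AllPairs.Properties as AllPairs
open import Data.List.Relation.Unary.Any as Any using (Any; here; there)
open import Data.Nat.Base as ℕ using (ℕ; zero; suc; z≤n; s≤s)
import Data.Nat.Properties as ℕ
open import Data.Product.Base using (∃; ∃₂; _×_; _,_; proj₁; proj₂)
open import Data.Sum.Base using (_⊎_; inj₁; inj₂)
open import Data.Unit.Base using (⊤; tt)
open import Data.Vec.Functional using (Vector)
open import Function.Base using (_∘_)
open import Level using (0ℓ)
open import Relation.Binary.Bundles using (TotalOrder)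
open import Relation.Binary.PropositionalEquality.Core as ≡ using (_≡_; _≢_)
open import Relation.Nullary using (¬_; yes; no)
open import Relation.Unary using (Pred)
open import Defs
import Algebra.Construct.NaturalChoice.Max as MaxOf
import Algebra.Construct.NaturalChoice.MaxOp as MaxOp
import Algebra.Properties.Ring
import Algebra.Properties.Semiring.Exp
import Algebra.Properties.Semiring.Mult
import Algebra.Properties.Semiring.Mult.TCOptimised
import Algebra.Solver.Ring.NaturalCoefficients.Default
import Relation.Binary.Properties.TotalOrder
import Relation.Binary.Reasoning.PartialOrder

-- The obstacle is that the coefficients of a vector in the span are arbitrary. Rounding a
-- coefficient to `q ^ β` adds `β` to every letter of its block, so the blocks stand side by side
-- with unrelated shifts, and every resulting word has to match a target fixed before the vector is
-- known. Between two letters smaller than ℓ the number of letters ℓ therefore cannot be prescribed.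
-- With `m` blocks it can only be bounded, by `2 * m + 2`: two for each block whose smallest letter
-- is ℓ, and one for each of the two block ends that bound the stretch. The remedy is to give every
-- gap `p ≥ 2 * m + 2` separators and to prove the matching for all numbers of letters up to `p` at
-- once; this uniformity makes the induction over the levels close. The induction stops at level
-- `r`, where values are at most δ: from there on letters match each other freely and may be left
-- unmatched on the side of the vector, which accounts for the unequal lengths.

-- Ramsey's theorem with an explicit bound.

module Ramsey where

  open import Data.Fin.Base using (Fin; toℕ; combine)
  open import Data.Fin.Properties using (toℕ<n; toℕ-injective; combine-injective)
  open import Data.List.Base using (List; []; _∷_; _++_; [_]; length; initLast; _∷ʳ′_)
  open import Data.List.Properties using (length-++)
  open import Data.List.Relation.Binary.Sublist.Propositional
    using (_⊆_; []; _∷_; _∷ʳ_; ⊆-refl; ⊆-trans)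
  open import Data.List.Relation.Binary.Sublist.Propositional.Properties
    using (All-resp-⊆; ∷⁻; ++⁺; ++⁺ʳ)
  open import Data.List.Relation.Unary.All as All using (All; []; _∷_)
  open import Data.Nat.Base
  open import Data.Nat.Properties
  open import Relation.Binary.PropositionalEquality using (_≡_; refl; sym; trans; cong)
  open import Relation.Unary using (Pred; Decidable; ∁)

  -- The product colouring passed on at each step squares the number of colours, so the bound is
  -- doubly exponential in `j`. The inner `suc` is for the chosen first element, the outer one makes
  -- the pigeonhole hypothesis strict.
  endBound : ℕ → ℕ → ℕ
  endBound zero    c = 0
  endBound (suc j) c = suc (c * suc (endBound j (c * c)))

  ramseyBound : ℕ → ℕ → ℕ → ℕ
  ramseyBound zero    c M = M
  ramseyBound (suc k) c M = endBound (suc (ramseyBound k c M)) c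

  module _ {A : Set} where

    separate : ∀ {P : Pred A 0ℓ} → Decidable P → ∀ xs →
      ∃₂ λ ys zs → ys ⊆ xs × zs ⊆ xs × All P ys × All (∁ P) zs ×
                   length ys + length zs ≡ length xs
    separate P? [] = [] , [] , [] , [] , [] , [] , refl
    separate P? (x ∷ xs) with P? x | separate P? xs
    ... | yes px | ys , zs , ys⊆ , zs⊆ , pys , pzs , eq =
      x ∷ ys , zs , refl ∷ ys⊆ , x ∷ʳ zs⊆ , px ∷ pys , pzs , cong suc eq
    ... | no ¬px | ys , zs , ys⊆ , zs⊆ , pys , pzs , eq =
      ys , x ∷ zs , x ∷ʳ ys⊆ , refl ∷ zs⊆ , pys , ¬px ∷ pzs ,
      trans (+-suc _ _) (cong suc eq)

    pigeonhole : ∀ c M (g : A → ℕ) xs → All (λ x → g x < c) xs → c * M < length xs →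
      ∃₂ λ ys i → ys ⊆ xs × M ≤ length ys × All (λ x → g x ≡ i) ys
    pigeonhole zero M g (x ∷ xs) (() ∷ _) _
    pigeonhole (suc c) M g xs g<c big with separate (λ x → g x ≟ c) xs
    ... | ys , zs , ys⊆ , zs⊆ , pys , pzs , eq with M ≤? length ys
    ...   | yes M≤ = ys , c , ys⊆ , M≤ , pys
    ...   | no M≰ with pigeonhole c M g zs below enough
      where
      below : All (λ x → g x < c) zs
      below = All.zipWith (λ (g≢c , g<1+c) → ≤∧≢⇒< (s≤s⁻¹ g<1+c) g≢c)
                          (pzs , All-resp-⊆ zs⊆ g<c)
      enough : c * M < length zs
      enough = +-cancelˡ-< M _ _ (begin-strict
        M + c * M              <⟨ big ⟩
        length xs              ≡⟨ eq ⟨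
        length ys + length zs  ≤⟨ +-monoˡ-≤ (length zs) (<⇒≤ (≰⇒> M≰)) ⟩
        M + length zs          ∎)
        where open ≤-Reasoning
    ...     | us , i , us⊆ , M≤ , pus = us , i , ⊆-trans us⊆ zs⊆ , M≤ , pus

    -- No length is fixed, because one step of the construction treats lists together with their
    -- extensions by the chosen element.
    EndHomogeneous : ∀ {c} → (List A → Fin c) → List A → Set
    EndHomogeneous χ zs = ∀ t {y y′} → t ++ [ y ] ⊆ zs → t ++ [ y′ ] ⊆ zs →
                          χ (t ++ [ y ]) ≡ χ (t ++ [ y′ ])

    -- Once x is chosen as the first element, the rest only has to be
    -- end-homogeneous for the product of χ and χ (x ∷_).
    endHomogeneous : ∀ j {c} (χ : List A → Fin c) xs → endBound j c ≤ length xs →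
      ∃ λ zs → zs ⊆ xs × j ≤ length zs × EndHomogeneous χ zs
    endHomogeneous zero χ [] _ = [] , [] , z≤n , λ { [] () ; (_ ∷ _) () }
    endHomogeneous zero χ (x ∷ xs) _ with endHomogeneous zero χ xs z≤n
    ... | zs , zs⊆ , le , h = zs , x ∷ʳ zs⊆ , le , h
    endHomogeneous (suc j) {c} χ xs big
      with pigeonhole c (suc (endBound j (c * c))) (λ x → toℕ (χ [ x ])) xs
             (All.universal (λ x → toℕ<n (χ [ x ])) xs) big
    ... | x ∷ xs′ , i , xs⊆ , s≤s big′ , mono
      with endHomogeneous j (λ t → combine (χ t) (χ (x ∷ t))) xs′ big′
    ...   | zs , zs⊆ , le , h =
      x ∷ zs , ⊆-trans (refl ∷ zs⊆) xs⊆ , s≤s le , homogeneous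
      where
      single : ∀ {y} → [ y ] ⊆ x ∷ zs → toℕ (χ [ y ]) ≡ i
      single s with All-resp-⊆ (⊆-trans s (refl ∷ zs⊆)) mono
      ... | eq ∷ [] = eq

      components : ∀ t {y y′} → t ++ [ y ] ⊆ zs → t ++ [ y′ ] ⊆ zs →
        χ (t ++ [ y ]) ≡ χ (t ++ [ y′ ]) × χ (x ∷ t ++ [ y ]) ≡ χ (x ∷ t ++ [ y′ ])
      components t s s′ = combine-injective _ _ _ _ (h t s s′)

      homogeneous : EndHomogeneous χ (x ∷ zs)
      homogeneous [] s s′ = toℕ-injective (trans (single s) (sym (single s′)))
      homogeneous (a ∷ t) (_ ∷ʳ s) (_ ∷ʳ s′) = proj₁ (components (a ∷ t) s s′)
      -- `x` may occur again in `zs`, so `s′` need not use the first position; in either case its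
      -- tail embeds into `zs`.
      homogeneous (a ∷ t) (refl ∷ s) s′ = proj₂ (components t s (∷⁻ s′))
      homogeneous (a ∷ t) s (refl ∷ s′) = proj₂ (components t (∷⁻ s) s′)

    Homogeneous : ∀ {c} → ℕ → (List A → Fin c) → List A → Set
    Homogeneous k χ ys = ∃ λ i → ∀ {u} → u ⊆ ys → length u ≡ k → χ u ≡ i

    -- In an end-homogeneous list the last element of a sublist may be replaced by the last element
    -- `z` of the whole list without changing the colour. This leaves a colouring of lists of length
    -- `k`; the `suc` in `ramseyBound` pays for `z`.
    ramsey : ∀ k {c} M (χ : List A → Fin c) xs → ramseyBound k c M ≤ length xs →
      ∃ λ ys → ys ⊆ xs × M ≤ length ys × Homogeneous k χ ys
    ramsey zero M χ xs big = xs , ⊆-refl , big , χ [] , λ { {[]} _ _ → refl }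
    ramsey (suc k) {c} M χ xs big
      with endHomogeneous (suc (ramseyBound k c M)) χ xs big
    ... | zs , zs⊆ , big′ , h with initLast zs
    ...   | zs′ ∷ʳ′ z with ramsey k M (λ t → χ (t ++ [ z ])) zs′
                           (s≤s⁻¹ (≤-trans big′ (≤-reflexive
                             (trans (length-++ zs′) (+-comm _ 1)))))
    ...     | ys , ys⊆ , M≤ , i , mono =
      ys , ⊆-trans ys⊆ (⊆-trans (++⁺ʳ [ z ] ⊆-refl) zs⊆) , M≤ , i , λ {u} → homogeneous u
      where
      homogeneous : ∀ u → u ⊆ ys → length u ≡ suc k → χ u ≡ i
      homogeneous u u⊆ len with initLast u
      homogeneous .(t ++ [ y ]) u⊆ len | t ∷ʳ′ y =
        trans (h t (⊆-trans u⊆ (⊆-trans ys⊆ (++⁺ʳ [ z ] ⊆-refl)))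
                   (++⁺ (⊆-trans t⊆ ys⊆) ⊆-refl))
              (mono t⊆ (suc-injective (trans (sym (trans (length-++ t) (+-comm _ 1))) len)))
        where
        t⊆ : t ⊆ ys
        t⊆ = ⊆-trans (++⁺ʳ [ y ] ⊆-refl) u⊆

-- Matching of words over ℕ.

module Patterns where

  open import Data.List.Base
    using (List; []; _∷_; _++_; length; replicate; concat; concatMap; map)
  open import Data.List.Membership.Propositional using (_∈_)
  open import Data.List.Properties
    using (length-++; length-replicate; ++-assoc; ++-identityʳ; map-++; map-replicate; concat-++)
  open import Data.List.Relation.Unary.All as All using (All; []; _∷_)
  open import Data.List.Relation.Unary.All.Properties using (++⁺; replicate⁺)
  open import Data.List.Relation.Unary.Any using (here; there)
  open import Data.Maybe.Base using (Maybe; just; nothing)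
  open import Data.Maybe.Relation.Unary.All as Maybe using (just; nothing)
  open import Data.Nat.Base
  open import Data.Nat.Properties
  open import Relation.Binary.PropositionalEquality
    using (_≡_; refl; sym; trans; cong; cong₂; subst; module ≡-Reasoning)

  -- A letter stands for a power of `q`: a difference of one level costs at most δ, and from level
  -- `R` on all values are at most δ.
  data Close (R a b : ℕ) : Set where
    near : a ≤ suc b → b ≤ suc a → Close R a b
    deep : R ≤ a → R ≤ b → Close R a b

  -- The relation is asymmetric: the right-hand word is the target, whose copies must all have the
  -- same length for Ramsey's theorem to apply, so none of its letters is skipped. On the side of
  -- the vector a letter may be left out if its value is small.
  data Match (R : ℕ) : List ℕ → List ℕ → Set where
    []   : Match R [] []
    skip : ∀ {a as bs} → R ≤ a → Match R as bs → Match R (a ∷ as) bs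
    take : ∀ {a b as bs} → Close R a b → Match R as bs → Match R (a ∷ as) (b ∷ bs)

  module _ {R : ℕ} where

    Match-++ : ∀ {as bs as′ bs′} → Match R as bs → Match R as′ bs′ →
               Match R (as ++ as′) (bs ++ bs′)
    Match-++ []         m′ = m′
    Match-++ (skip r m) m′ = skip r (Match-++ m m′)
    Match-++ (take c m) m′ = take c (Match-++ m m′)

    Match-deep : ∀ {as} bs → All (R ≤_) as → All (R ≤_) bs → length bs ≤ length as →
                 Match R as bs
    Match-deep []       []       []       _        = []
    Match-deep []       (p ∷ ps) []       _        = skip p (Match-deep [] ps [] z≤n)
    Match-deep (b ∷ bs) (p ∷ ps) (q ∷ qs) (s≤s le) = take (deep p q) (Match-deep bs ps qs le)

  -- Nested words and rich words.

  module Words (p : ℕ) where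

    separated : ℕ → List ℕ → ℕ → List ℕ
    separated zero    u ℓ = u
    separated (suc a) u ℓ = u ++ ℓ ∷ separated a u ℓ

    -- By definition `gap z (suc k) ℓ` is `word z k p (suc ℓ)`. Hence `target (suc k) 0 ℓ` and
    -- `target k p (suc ℓ)` are the same word, an identification that the matching lemmas use
    -- silently.
    gap : (z k ℓ : ℕ) → List ℕ
    gap z zero    ℓ = replicate z ℓ
    gap z (suc k) ℓ = separated p (gap z k (suc ℓ)) (suc ℓ)

    -- The bottom gaps are padded with z letters: none in the target, and p in a block, where
    -- they make room for those letters of the target whose values are at most δ.
    word : (z k a ℓ : ℕ) → List ℕ
    word z k a ℓ = separated a (gap z k ℓ) ℓ

    target : (k a ℓ : ℕ) → List ℕ
    target = word 0

    source : (k a ℓ : ℕ) → List ℕ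
    source = word p

    separated-levels : ∀ a {u ℓ} → All (ℓ ≤_) u → All (ℓ ≤_) (separated a u ℓ)
    separated-levels zero    ls = ls
    separated-levels (suc a) ls = ++⁺ ls (≤-refl ∷ separated-levels a ls)

    gap-levels : ∀ z k ℓ → All (ℓ ≤_) (gap z k ℓ)
    gap-levels z zero    ℓ = replicate⁺ z ≤-refl
    gap-levels z (suc k) ℓ =
      All.map (≤-trans (n≤1+n ℓ)) (separated-levels p (gap-levels z k (suc ℓ)))

    word-levels : ∀ z k a ℓ → All (ℓ ≤_) (word z k a ℓ)
    word-levels z k a ℓ = separated-levels a (gap-levels z k ℓ)

    length-separated : ∀ a u ℓ → length u ≤ length (separated a u ℓ)
    length-separated zero    u ℓ = ≤-refl
    length-separated (suc a) u ℓ = ≤-trans (m≤m+n _ _) (≤-reflexive (sym (length-++ u)))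

    length-gap : ∀ k ℓ → p ≤ length (gap p k ℓ)
    length-gap zero    ℓ = ≤-reflexive (sym (length-replicate p))
    length-gap (suc k) ℓ = ≤-trans (length-gap k (suc ℓ)) (length-separated p _ (suc ℓ))

    length-source : ∀ k a ℓ → p ≤ length (source k a ℓ)
    length-source k a ℓ = ≤-trans (length-gap k ℓ) (length-separated a _ ℓ)

    length-target₀ : ∀ a ℓ → length (target 0 a ℓ) ≡ a
    length-target₀ zero    ℓ = refl
    length-target₀ (suc a) ℓ = cong suc (length-target₀ a ℓ)

    data Split (Q : List ℕ → Set) (ℓ : ℕ) : ℕ → List ℕ → Set where
      last : ∀ {u} → Q u → Split Q ℓ 0 u
      _∷_  : ∀ {q u as} → Q u → Split Q ℓ q as → Split Q ℓ (suc q) (u ++ ℓ ∷ as)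

    data RichSplit (Q P : List ℕ → Set) (ℓ : ℕ) : ℕ → List ℕ → Set where
      last  : ∀ {u} → P u → RichSplit Q P ℓ 0 u
      here  : ∀ {q u as} → P u → Split Q ℓ q as → RichSplit Q P ℓ (suc q) (u ++ ℓ ∷ as)
      there : ∀ {q u as} → Q u → RichSplit Q P ℓ q as → RichSplit Q P ℓ (suc q) (u ++ ℓ ∷ as)

    -- In a rich word with letters ℓ, some gap is pure, hence can absorb up to p more letters.
    Pure : (k ℓ : ℕ) → List ℕ → Set
    Pure k ℓ u = ∃ λ n → k ≤ n × u ≡ source n p ℓ

    Rich : (k ℓ : ℕ) → List ℕ → Set
    Rich zero    ℓ as = p ≤ length as × All (ℓ ≤_) as
    Rich (suc k) ℓ as = ∃ λ q → q ≤ p × RichSplit (Rich k (suc ℓ)) (Pure k (suc ℓ)) ℓ q as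

    source-split : ∀ k a ℓ {Q : List ℕ → Set} → Q (source k p (suc ℓ)) →
                   Split Q ℓ a (source (suc k) a ℓ)
    source-split k zero    ℓ q = last q
    source-split k (suc a) ℓ q = q ∷ source-split k a ℓ q

    source-rich : ∀ {k n} a ℓ → k ≤ n → a ≤ p → Rich k ℓ (source n a ℓ)
    source-rich {zero}  {n}     a ℓ _         _   = length-source n a ℓ , word-levels p n a ℓ
    source-rich {suc k} {suc n} a ℓ (s≤s k≤n) a≤p = a , a≤p , rich a
      where
      rich : ∀ a → RichSplit (Rich k (suc ℓ)) (Pure k (suc ℓ)) ℓ a (source (suc n) a ℓ)
      rich zero    = last (n , k≤n , refl)
      rich (suc a) = here (n , k≤n , refl)
                          (source-split n a ℓ (source-rich p (suc ℓ) k≤n ≤-refl))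

    module _ {R : ℕ} where

      -- Here a and q are the numbers of letters ℓ on the two sides.
      module _ {k ℓ : ℕ}
        (match : ∀ {as a} → Rich k (suc ℓ) as → a ≤ p → Match R as (target k a (suc ℓ)))
        where

        same : ∀ {a} → Close R a a
        same = near (n≤1+n _) (n≤1+n _)

        -- The `q` remaining letters `ℓ` of the vector are matched with the first `q` separators
        -- `suc ℓ` of the target gap. The rich piece before each of them meets `target k 0 (suc ℓ)`,
        -- whatever its own number of separators; `match` allows this.
        match-surplus : ∀ {q as} a → q ≤ a → a ≤ p → Split (Rich k (suc ℓ)) ℓ q as →
                        Match R as (target k a (suc ℓ))
        match-surplus a       _         a≤p (last r) = match r a≤p
        match-surplus (suc a) (s≤s q≤a) a≤p (r ∷ rs) =
          Match-++ (match r z≤n)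
                   (take (near (m≤n⇒m≤1+n (n≤1+n _)) ≤-refl)
                         (match-surplus a q≤a (<⇒≤ a≤p) rs))

        -- Letters `ℓ` are matched in order until the target has none left. What remains of the
        -- target is then a single gap, and it takes the whole surplus.
        match-split : ∀ {q as} a → a ≤ q → q ≤ p → Split (Rich k (suc ℓ)) ℓ q as →
                      Match R as (target (suc k) a ℓ)
        match-split zero    _         q≤p rs       = match-surplus p q≤p ≤-refl rs
        match-split (suc a) (s≤s a≤q) q≤p (r ∷ rs) =
          Match-++ (match r ≤-refl) (take same (match-split a a≤q (<⇒≤ q≤p) rs))

        -- The mirror image of a surplus: letters `ℓ` of the target are matched with separators
        -- `suc ℓ` of a pure piece. Each `source n 0 (suc ℓ)` between these is a piece without
        -- separators, yet it matches a target gap with `p` of them.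
        match-source : ∀ {n} u a → k ≤ n → u ≤ a → a ≤ p →
                       Match R (source n a (suc ℓ)) (target (suc k) u ℓ)
        match-source zero    a       k≤n _         a≤p = match (source-rich a _ k≤n a≤p) ≤-refl
        match-source (suc u) (suc a) k≤n (s≤s u≤a) a≤p =
          Match-++ (match (source-rich 0 _ k≤n z≤n) ≤-refl)
                   (take (near ≤-refl (m≤n⇒m≤1+n (n≤1+n _)))
                         (match-source u a k≤n u≤a (<⇒≤ a≤p)))

        match-source-split : ∀ {n q as} u a → k ≤ n → u ≤ a → a ≤ p → q ≤ p →
          Split (Rich k (suc ℓ)) ℓ q as →
          Match R (source n a (suc ℓ) ++ ℓ ∷ as) (target (suc k) (u + suc q) ℓ)
        match-source-split {q = q} zero a k≤n _ a≤p q≤p rs =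
          Match-++ (match (source-rich a _ k≤n a≤p) ≤-refl)
                   (take same (match-split q ≤-refl q≤p rs))
        match-source-split {n} {q} {as} (suc u) (suc a) k≤n (s≤s u≤a) a≤p q≤p rs =
          subst (λ as′ → Match R as′ (target (suc k) (suc u + suc q) ℓ))
                (sym (++-assoc (source n 0 (suc ℓ)) _ _))
                (Match-++ (match (source-rich 0 _ k≤n z≤n) ≤-refl)
                          (take (near ≤-refl (m≤n⇒m≤1+n (n≤1+n _)))
                                (match-source-split u a k≤n u≤a (<⇒≤ a≤p) q≤p rs)))

        -- Before the pure piece the letters `ℓ` are matched one by one. The pure piece absorbs all
        -- the missing letters, so that the numbers agree after it.
        match-deficit : ∀ {q as} a → q ≤ a → a ≤ p →
          RichSplit (Rich k (suc ℓ)) (Pure k (suc ℓ)) ℓ q as → Match R as (target (suc k) a ℓ)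
        match-deficit a _ a≤p (last (n , k≤n , refl)) = match-source a p k≤n a≤p ≤-refl
        match-deficit a q≤a a≤p (here {q} {as = as} (n , k≤n , refl) rs) =
          subst (λ a′ → Match R (source n p (suc ℓ) ++ ℓ ∷ as) (target (suc k) a′ ℓ))
                (m∸n+n≡m q≤a)
                (match-source-split (a ∸ suc q) p k≤n (≤-trans (m∸n≤m a (suc q)) a≤p) ≤-refl
                                    (≤-trans (n≤1+n q) (≤-trans q≤a a≤p)) rs)
        match-deficit (suc a) (s≤s q≤a) a≤p (there r rs) =
          Match-++ (match r ≤-refl) (take same (match-deficit a q≤a (<⇒≤ a≤p) rs))

      forget : ∀ {k ℓ q as} → RichSplit (Rich k (suc ℓ)) (Pure k (suc ℓ)) ℓ q as →
               Split (Rich k (suc ℓ)) ℓ q as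
      forget (last (n , k≤n , refl))    = last (source-rich p _ k≤n ≤-refl)
      forget (here (n , k≤n , refl) rs) = source-rich p _ k≤n ≤-refl ∷ rs
      forget (there r rs)               = r ∷ forget rs

      -- The freedom in `a` is essential for the induction: wherever a letter `ℓ` is paired with a
      -- letter `suc ℓ`, the hypothesis is applied to a target with the extreme value `0` or `p`.
      rich-match : ∀ k {ℓ as a} → k + ℓ ≡ R → Rich k ℓ as → a ≤ p → Match R as (target k a ℓ)
      rich-match zero {ℓ} {as} {a} refl (p≤ , ls) a≤p =
        Match-deep (target 0 a ℓ) ls (word-levels 0 0 a ℓ)
                   (≤-trans (≤-reflexive (length-target₀ a ℓ)) (≤-trans a≤p p≤))
      rich-match (suc k) {ℓ} {a = a} eq (q , q≤p , rs) a≤p with ≤-total a q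
      ... | inj₁ a≤q = match-split (rich-match k (trans (+-suc k ℓ) eq)) a a≤q q≤p (forget rs)
      ... | inj₂ q≤a = match-deficit (rich-match k (trans (+-suc k ℓ) eq)) a q≤a a≤p rs

    -- A block is a word in which, to either side of its two letters of top level, a
    -- decreasing staircase of gaps leads to the boundary.  This way the letters ℓ between
    -- two consecutive letters of level < ℓ remain few even across the boundaries of blocks,
    -- and one of the gaps between these letters ℓ is a full word.
    edgeˡ edgeʳ : (n ℓ : ℕ) → List ℕ
    edgeˡ zero    ℓ = replicate p ℓ
    edgeˡ (suc n) ℓ = edgeˡ n (suc ℓ) ++ ℓ ∷ source n p (suc ℓ)
    edgeʳ zero    ℓ = replicate p ℓ
    edgeʳ (suc n) ℓ = source n p (suc ℓ) ++ ℓ ∷ edgeʳ n (suc ℓ)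

    block : (n ℓ : ℕ) → List ℕ
    block n ℓ = edgeˡ (suc n) ℓ ++ ℓ ∷ edgeʳ n (suc ℓ)

    below : ∀ {ℓ us} → All (suc ℓ ≤_) us → All (ℓ ≤_) us
    below = All.map (≤-trans (n≤1+n _))

    edgeˡ-levels : ∀ n ℓ → All (ℓ ≤_) (edgeˡ n ℓ)
    edgeˡ-levels zero    ℓ = replicate⁺ p ≤-refl
    edgeˡ-levels (suc n) ℓ =
      ++⁺ (below (edgeˡ-levels n (suc ℓ))) (≤-refl ∷ below (word-levels p n p (suc ℓ)))

    edgeʳ-levels : ∀ n ℓ → All (ℓ ≤_) (edgeʳ n ℓ)
    edgeʳ-levels zero    ℓ = replicate⁺ p ≤-refl
    edgeʳ-levels (suc n) ℓ =
      ++⁺ (below (word-levels p n p (suc ℓ))) (≤-refl ∷ below (edgeʳ-levels n (suc ℓ)))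

    block-levels : ∀ n ℓ → All (ℓ ≤_) (block n ℓ)
    block-levels n ℓ = ++⁺ (edgeˡ-levels (suc n) ℓ) (≤-refl ∷ below (edgeʳ-levels n (suc ℓ)))

    m≤length-++ˡ : ∀ {m} (us : List ℕ) {vs} → m ≤ length us → m ≤ length (us ++ vs)
    m≤length-++ˡ us le = ≤-trans le (≤-trans (m≤m+n _ _) (≤-reflexive (sym (length-++ us))))

    m≤length-++ʳ : ∀ {m} (us : List ℕ) {vs} → m ≤ length vs → m ≤ length (us ++ vs)
    m≤length-++ʳ us le = ≤-trans le (≤-trans (m≤n+m _ _) (≤-reflexive (sym (length-++ us))))

    length-edgeˡ : ∀ n ℓ → p ≤ length (edgeˡ n ℓ)
    length-edgeˡ zero    ℓ = ≤-reflexive (sym (length-replicate p))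
    length-edgeˡ (suc n) ℓ = m≤length-++ˡ (edgeˡ n (suc ℓ)) (length-edgeˡ n (suc ℓ))

    length-edgeʳ : ∀ n ℓ → p ≤ length (edgeʳ n ℓ)
    length-edgeʳ zero    ℓ = ≤-reflexive (sym (length-replicate p))
    length-edgeʳ (suc n) ℓ = m≤length-++ˡ (source n p (suc ℓ)) (length-source n p (suc ℓ))

    length-block : ∀ n ℓ → p ≤ length (block n ℓ)
    length-block n ℓ = m≤length-++ˡ (edgeˡ (suc n) ℓ) (length-edgeˡ (suc n) ℓ)

    -- Shifts of words, which correspond to multiplication by powers of `q`.

    map-separated : ∀ d a u ℓ →
      map (d +_) (separated a u ℓ) ≡ separated a (map (d +_) u) (d + ℓ)
    map-separated d zero    u ℓ = refl
    map-separated d (suc a) u ℓ =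
      trans (map-++ (d +_) u _) (cong (λ v → map (d +_) u ++ d + ℓ ∷ v) (map-separated d a u ℓ))

    map-gap : ∀ d z k ℓ → map (d +_) (gap z k ℓ) ≡ gap z k (d + ℓ)
    map-gap d z zero    ℓ = map-replicate (d +_) z ℓ
    map-gap d z (suc k) ℓ = begin
      map (d +_) (separated p (gap z k (suc ℓ)) (suc ℓ))
        ≡⟨ map-separated d p (gap z k (suc ℓ)) (suc ℓ) ⟩
      separated p (map (d +_) (gap z k (suc ℓ))) (d + suc ℓ)
        ≡⟨ cong (λ u → separated p u (d + suc ℓ)) (map-gap d z k (suc ℓ)) ⟩
      separated p (gap z k (d + suc ℓ)) (d + suc ℓ)
        ≡⟨ cong (λ i → separated p (gap z k i) i) (+-suc d ℓ) ⟩
      separated p (gap z k (suc (d + ℓ))) (suc (d + ℓ))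
        ∎
      where open ≡-Reasoning

    map-word : ∀ d z k a ℓ → map (d +_) (word z k a ℓ) ≡ word z k a (d + ℓ)
    map-word d z k a ℓ =
      trans (map-separated d a _ ℓ) (cong (λ u → separated a u (d + ℓ)) (map-gap d z k ℓ))

    map-source : ∀ d n ℓ → map (d +_) (source n p (suc ℓ)) ≡ source n p (suc (d + ℓ))
    map-source d n ℓ = trans (map-word d p n p (suc ℓ)) (cong (source n p) (+-suc d ℓ))

    map-edgeˡ : ∀ d n ℓ → map (d +_) (edgeˡ n ℓ) ≡ edgeˡ n (d + ℓ)
    map-edgeˡ d zero    ℓ = map-replicate (d +_) p ℓ
    map-edgeˡ d (suc n) ℓ = trans (map-++ (d +_) (edgeˡ n (suc ℓ)) _)
      (cong₂ (λ u v → u ++ d + ℓ ∷ v)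
             (trans (map-edgeˡ d n (suc ℓ)) (cong (edgeˡ n) (+-suc d ℓ))) (map-source d n ℓ))

    map-edgeʳ : ∀ d n ℓ → map (d +_) (edgeʳ n ℓ) ≡ edgeʳ n (d + ℓ)
    map-edgeʳ d zero    ℓ = map-replicate (d +_) p ℓ
    map-edgeʳ d (suc n) ℓ = trans (map-++ (d +_) (source n p (suc ℓ)) _)
      (cong₂ (λ u v → u ++ d + ℓ ∷ v) (map-source d n ℓ)
             (trans (map-edgeʳ d n (suc ℓ)) (cong (edgeʳ n) (+-suc d ℓ))))

    map-block : ∀ d n ℓ → map (d +_) (block n ℓ) ≡ block n (d + ℓ)
    map-block d n ℓ = trans (map-++ (d +_) (edgeˡ (suc n) ℓ) _)
      (cong₂ (λ u v → u ++ d + ℓ ∷ v) (map-edgeˡ d (suc n) ℓ)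
             (trans (map-edgeʳ d n (suc ℓ)) (cong (edgeʳ n) (+-suc d ℓ))))

    -- Lengths of words.

    1+length-++ : ∀ (us : List ℕ) {v vs} →
      suc (length (us ++ v ∷ vs)) ≡ suc (length us) + suc (length vs)
    1+length-++ us = cong suc (length-++ us)

    -- With one letter added at the end, every piece can be counted together with the letter after
    -- it, so lengths multiply and become powers of `suc p`.
    1+length-separated : ∀ a u ℓ →
      suc (length (separated a u ℓ)) ≡ suc a * suc (length u)
    1+length-separated zero    u ℓ = sym (+-identityʳ _)
    1+length-separated (suc a) u ℓ =
      trans (1+length-++ u) (cong (suc (length u) +_) (1+length-separated a u ℓ))

    1+length-gap : ∀ z k ℓ → suc (length (gap z k ℓ)) ≡ suc p ^ k * suc z
    1+length-gap z zero    ℓ = trans (cong suc (length-replicate z)) (sym (+-identityʳ _))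
    1+length-gap z (suc k) ℓ = begin
      suc (length (separated p (gap z k (suc ℓ)) (suc ℓ))) ≡⟨ 1+length-separated p (gap z k (suc ℓ)) (suc ℓ) ⟩
      suc p * suc (length (gap z k (suc ℓ)))               ≡⟨ cong (suc p *_) (1+length-gap z k (suc ℓ)) ⟩
      suc p * (suc p ^ k * suc z)                          ≡⟨ *-assoc (suc p) (suc p ^ k) (suc z) ⟨
      suc p * suc p ^ k * suc z                            ∎
      where open ≡-Reasoning

    1+length-target : ∀ k → suc (length (target k 1 0)) ≡ 2 * suc p ^ k
    1+length-target k = trans (1+length-separated 1 (gap 0 k 0) 0)
      (cong (2 *_) (trans (1+length-gap 0 k 0) (*-identityʳ (suc p ^ k))))

    1+length-source : ∀ k ℓ → suc (length (source k p ℓ)) ≡ suc p ^ (2 + k)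
    1+length-source k ℓ = trans (1+length-separated p (gap p k ℓ) ℓ)
      (cong (suc p *_) (trans (1+length-gap p k ℓ) (*-comm (suc p ^ k) (suc p))))

    module _ (1≤p : 1 ≤ p) where

      private
        double : ∀ e → suc p ^ e + suc p ^ e ≤ suc p ^ suc e
        double e = +-monoʳ-≤ (suc p ^ e)
          (≤-trans (≤-reflexive (sym (+-identityʳ _))) (*-monoˡ-≤ (suc p ^ e) 1≤p))

      1+length-edgeˡ : ∀ n ℓ → suc (length (edgeˡ n ℓ)) ≤ suc p ^ (2 + n)
      1+length-edgeˡ zero    ℓ =
        ≤-trans (≤-reflexive (cong suc (length-replicate p))) (m≤m*n (suc p) (suc p ^ 1))
      1+length-edgeˡ (suc n) ℓ = begin
        suc (length (edgeˡ (suc n) ℓ))       ≡⟨ 1+length-++ (edgeˡ n (suc ℓ)) ⟩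
        suc (length (edgeˡ n (suc ℓ))) + suc (length (source n p (suc ℓ)))
          ≤⟨ +-mono-≤ (1+length-edgeˡ n (suc ℓ)) (≤-reflexive (1+length-source n (suc ℓ))) ⟩
        suc p ^ (2 + n) + suc p ^ (2 + n)    ≤⟨ double (2 + n) ⟩
        suc p ^ (3 + n)                      ∎
        where open ≤-Reasoning

      1+length-edgeʳ : ∀ n ℓ → suc (length (edgeʳ n ℓ)) ≤ suc p ^ (2 + n)
      1+length-edgeʳ zero    ℓ =
        ≤-trans (≤-reflexive (cong suc (length-replicate p))) (m≤m*n (suc p) (suc p ^ 1))
      1+length-edgeʳ (suc n) ℓ = begin
        suc (length (edgeʳ (suc n) ℓ))       ≡⟨ 1+length-++ (source n p (suc ℓ)) ⟩
        suc (length (source n p (suc ℓ))) + suc (length (edgeʳ n (suc ℓ)))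
          ≤⟨ +-mono-≤ (≤-reflexive (1+length-source n (suc ℓ))) (1+length-edgeʳ n (suc ℓ)) ⟩
        suc p ^ (2 + n) + suc p ^ (2 + n)    ≤⟨ double (2 + n) ⟩
        suc p ^ (3 + n)                      ∎
        where open ≤-Reasoning

      1+length-block : ∀ n ℓ → suc (length (block n ℓ)) ≤ suc p ^ (4 + n)
      1+length-block n ℓ = begin
        suc (length (block n ℓ))             ≡⟨ 1+length-++ (edgeˡ (suc n) ℓ) ⟩
        suc (length (edgeˡ (suc n) ℓ)) + suc (length (edgeʳ n (suc ℓ)))
          ≤⟨ +-mono-≤ (1+length-edgeˡ (suc n) ℓ)
               (≤-trans (1+length-edgeʳ n (suc ℓ)) (^-monoʳ-≤ (suc p) (n≤1+n (2 + n)))) ⟩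
        suc p ^ (3 + n) + suc p ^ (3 + n)    ≤⟨ double (3 + n) ⟩
        suc p ^ (4 + n)                      ∎
        where open ≤-Reasoning

    -- Shifted blocks side by side form a rich word.

    data Occurrences (ℓ : ℕ) : List ℕ → Set where
      none : ∀ {βs} → All (suc ℓ ≤_) βs → Occurrences ℓ βs
      next : ∀ {αs βs} → All (suc ℓ ≤_) αs → Occurrences ℓ βs → Occurrences ℓ (αs ++ ℓ ∷ βs)

    occurrences : ∀ {ℓ βs} → All (ℓ ≤_) βs → Occurrences ℓ βs
    occurrences [] = none []
    occurrences {ℓ} {β ∷ βs} (le ∷ les) with m≤n⇒m<n∨m≡n le | occurrences les
    ... | inj₂ refl | o           = next [] o
    ... | inj₁ lt   | none ls     = none (lt ∷ ls)
    ... | inj₁ lt   | next ls o   = next (lt ∷ ls) o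

    module Blocks (n N : ℕ) (2N+2≤p : 2 * N + 2 ≤ p) where

      blocks : List ℕ → List ℕ
      blocks = concatMap (block n)

      -- A context stretches from a letter smaller than `ℓ` in one block to the next such letter in
      -- a later block. So it opens with the right end of the former and closes with the left end of
      -- the latter; `nothing` stands for an end of the whole word.
      openingEdge closingEdge : Maybe ℕ → ℕ → List ℕ
      openingEdge nothing  ℓ = []
      openingEdge (just n) ℓ = edgeʳ n ℓ
      closingEdge nothing  ℓ = []
      closingEdge (just n) ℓ = edgeˡ n ℓ

      -- Excludes the contexts that have no edge and only blocks with larger shifts. These contain
      -- no letter `ℓ`, may be empty, and need not be rich.
      data Nontrivial (ℓ : ℕ) : Maybe ℕ → List ℕ → Maybe ℕ → Set where
        left   : ∀ {i βs b} → Nontrivial ℓ (just i) βs b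
        right  : ∀ {a βs j} → Nontrivial ℓ a βs (just j)
        middle : ∀ {a βs b} → ℓ ∈ βs → Nontrivial ℓ a βs b

      context : Maybe ℕ → List ℕ → Maybe ℕ → ℕ → List ℕ
      context a βs b ℓ = openingEdge a ℓ ++ blocks βs ++ closingEdge b ℓ

      context-levels : ∀ a {βs} b {ℓ} → All (ℓ ≤_) βs → All (ℓ ≤_) (context a βs b ℓ)
      context-levels a {βs} b {ℓ} ls = ++⁺ (left-levels a) (++⁺ (blocks-levels ls) (right-levels b))
        where
        left-levels : ∀ a → All (ℓ ≤_) (openingEdge a ℓ)
        left-levels nothing  = []
        left-levels (just n) = edgeʳ-levels n ℓ
        right-levels : ∀ b → All (ℓ ≤_) (closingEdge b ℓ)
        right-levels nothing  = []
        right-levels (just n) = edgeˡ-levels n ℓ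
        blocks-levels : ∀ {βs} → All (ℓ ≤_) βs → All (ℓ ≤_) (blocks βs)
        blocks-levels []                   = []
        blocks-levels (_∷_ {x = β} le les) =
          ++⁺ (All.map (≤-trans le) (block-levels n β)) (blocks-levels les)

      length-context : ∀ {a βs b ℓ} → Nontrivial ℓ a βs b → p ≤ length (context a βs b ℓ)
      length-context {just i} {ℓ = ℓ} left = m≤length-++ˡ (edgeʳ i ℓ) (length-edgeʳ i ℓ)
      length-context {a} {βs} {just j} {ℓ} right =
        m≤length-++ʳ (openingEdge a ℓ) (m≤length-++ʳ (blocks βs) (length-edgeˡ j ℓ))
      length-context {a} {βs} {b} {ℓ} (middle ℓ∈) =
        m≤length-++ʳ (openingEdge a ℓ) (m≤length-++ˡ (blocks βs) (length-blocks ℓ∈))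
        where
        length-blocks : ∀ {βs} → ℓ ∈ βs → p ≤ length (blocks βs)
        length-blocks (here refl)          = m≤length-++ˡ (block n ℓ) (length-block n ℓ)
        length-blocks (there {x = β} ℓ∈βs) = m≤length-++ʳ (block n β) (length-blocks ℓ∈βs)

      blocks-++ : ∀ αs βs → blocks (αs ++ βs) ≡ blocks αs ++ blocks βs
      blocks-++ αs βs = trans (cong concat (map-++ (block n) αs βs))
                              (sym (concat-++ (map (block n) αs) (map (block n) βs)))

      context-edge : ∀ w j αs ℓ → w ++ blocks αs ++ edgeˡ (suc j) ℓ ≡
        (w ++ blocks αs ++ edgeˡ j (suc ℓ)) ++ ℓ ∷ source j p (suc ℓ)
      context-edge w j αs ℓ = sym (trans (++-assoc w _ _) (cong (w ++_) (++-assoc (blocks αs) _ _)))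

      context-block : ∀ w αs βs b ℓ → w ++ blocks (αs ++ ℓ ∷ βs) ++ b ≡
        (w ++ blocks αs ++ edgeˡ n (suc ℓ)) ++
        ℓ ∷ (source n p (suc ℓ) ++ ℓ ∷ (edgeʳ n (suc ℓ) ++ blocks βs ++ b))
      context-block w αs βs b ℓ = begin
        w ++ blocks (αs ++ ℓ ∷ βs) ++ b
          ≡⟨ cong (λ v → w ++ v ++ b) (blocks-++ αs (ℓ ∷ βs)) ⟩
        w ++ (blocks αs ++ block n ℓ ++ blocks βs) ++ b
          ≡⟨ cong (w ++_) (++-assoc (blocks αs) _ b) ⟩
        w ++ blocks αs ++ (block n ℓ ++ blocks βs) ++ b
          ≡⟨ cong (λ v → w ++ blocks αs ++ v) (++-assoc (block n ℓ) _ b) ⟩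
        w ++ blocks αs ++ (edgeˡ (suc n) ℓ ++ ℓ ∷ edgeʳ n (suc ℓ)) ++ blocks βs ++ b
          ≡⟨ cong (λ v → w ++ blocks αs ++ v) (++-assoc (edgeˡ (suc n) ℓ) _ _) ⟩
        w ++ blocks αs ++ edgeˡ (suc n) ℓ ++ ℓ ∷ rest
          ≡⟨ cong (w ++_) (++-assoc (blocks αs) _ _) ⟨
        w ++ (blocks αs ++ edgeˡ (suc n) ℓ) ++ ℓ ∷ rest
          ≡⟨ ++-assoc w _ _ ⟨
        (w ++ blocks αs ++ edgeˡ (suc n) ℓ) ++ ℓ ∷ rest
          ≡⟨ cong (_++ ℓ ∷ rest) (context-edge w n αs ℓ) ⟩
        ((w ++ blocks αs ++ edgeˡ n (suc ℓ)) ++ ℓ ∷ source n p (suc ℓ)) ++ ℓ ∷ rest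
          ≡⟨ ++-assoc (w ++ blocks αs ++ edgeˡ n (suc ℓ)) _ _ ⟩
        (w ++ blocks αs ++ edgeˡ n (suc ℓ)) ++ ℓ ∷ (source n p (suc ℓ) ++ ℓ ∷ rest) ∎
        where
        open ≡-Reasoning
        rest = edgeʳ n (suc ℓ) ++ blocks βs ++ b

      Deep : ℕ → Maybe ℕ → Set
      Deep k = Maybe.All (k ≤_)

      ContextsRich : (k ℓ : ℕ) → Set
      ContextsRich k ℓ = ∀ a {βs} b → Deep k a → Deep k b → All (ℓ ≤_) βs → length βs ≤ N →
                         Nontrivial ℓ a βs b → Rich k ℓ (context a βs b ℓ)

      module _ {k ℓ : ℕ} (k≤n : k ≤ n) (rich : ContextsRich k (suc ℓ)) where

        pure : ∀ {i} → k ≤ i → Pure k (suc ℓ) (source i p (suc ℓ))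
        pure k≤i = _ , k≤i , refl

        source′ : ∀ {i} → k ≤ i → Rich k (suc ℓ) (source i p (suc ℓ))
        source′ k≤i = source-rich p (suc ℓ) k≤i ≤-refl

        length-αs : ∀ αs {βs} → length (αs ++ ℓ ∷ βs) ≤ N → length αs ≤ N
        length-αs αs = ≤-trans (m≤length-++ˡ αs ≤-refl)

        length-βs : ∀ αs {βs} → length (αs ++ ℓ ∷ βs) ≤ N → length βs ≤ N
        length-βs αs = ≤-trans (m≤length-++ʳ αs (n≤1+n _))

        count : ∀ αs {βs q} → q ≤ 2 * length βs + 1 → 2 + q ≤ 2 * length (αs ++ ℓ ∷ βs) + 1
        count αs {βs} {q} le = begin
          2 + q                            ≤⟨ +-monoʳ-≤ 2 le ⟩
          2 + (2 * length βs + 1)          ≡⟨ +-assoc 2 (2 * length βs) 1 ⟨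
          2 + 2 * length βs + 1            ≡⟨ cong (_+ 1) (*-suc 2 (length βs)) ⟨
          2 * suc (length βs) + 1
            ≤⟨ +-monoˡ-≤ 1 (*-monoʳ-≤ 2 (m≤length-++ʳ αs {ℓ ∷ βs} ≤-refl)) ⟩
          2 * length (αs ++ ℓ ∷ βs) + 1    ∎
          where open ≤-Reasoning

        -- The opening edge has already lost its letter `ℓ`. The remaining ones are the two central
        -- letters of each block with shift `ℓ` and at most one letter of the closing edge; the
        -- pieces between them are sources or contexts of the next level.
        split-context : ∀ i {βs} b → k ≤ i → Deep (suc k) b → Occurrences ℓ βs → length βs ≤ N →
          ∃ λ q → q ≤ 2 * length βs + 1 ×
                  Split (Rich k (suc ℓ)) ℓ q (edgeʳ i (suc ℓ) ++ blocks βs ++ closingEdge b ℓ)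
        split-context i nothing k≤i nothing (none ls) len =
          0 , z≤n , last (rich (just i) nothing (just k≤i) nothing ls len left)
        split-context i (just zero) k≤i (just ()) (none ls) len
        split-context i {βs} (just (suc j)) k≤i (just (s≤s k≤j)) (none ls) len =
          1 , m≤n+m 1 (2 * length βs) ,
          subst (Split _ ℓ 1) (sym (context-edge (edgeʳ i (suc ℓ)) j βs ℓ))
            (rich (just i) (just j) (just k≤i) (just k≤j) ls len left ∷ last (source′ k≤j))
        split-context i b k≤i deep-b (next {αs} {βs} ls o) len
          with split-context n b k≤n deep-b o (length-βs αs len)
        ... | q , q≤ , s =
          suc (suc q) , count αs q≤ ,
          subst (Split _ ℓ _) (sym (context-block (edgeʳ i (suc ℓ)) αs βs (closingEdge b ℓ) ℓ))
            (rich (just i) (just n) (just k≤i) (just k≤n) ls (length-αs αs len) left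
              ∷ source′ k≤n ∷ s)

        top-absent : ∀ {βs} → All (suc ℓ ≤_) βs → ℓ ∈ βs → ⊥
        top-absent (lt ∷ _)  (here refl) = <-irrefl refl lt
        top-absent (_ ∷ lts) (there ℓ∈)  = top-absent lts ℓ∈

        -- A pure piece is found beside the letter `ℓ` of an edge, or between the two central
        -- letters of a block with shift `ℓ`; the second letter is in the block for this purpose. A
        -- nontrivial context offers at least one of these places.
        rich-split-context : ∀ a {βs} b → Deep (suc k) a → Deep (suc k) b → Occurrences ℓ βs →
          length βs ≤ N → Nontrivial ℓ a βs b →
          ∃ λ q → q ≤ 2 * length βs + 2 ×
                  RichSplit (Rich k (suc ℓ)) (Pure k (suc ℓ)) ℓ q (context a βs b ℓ)
        rich-split-context (just (suc i)) {βs} b (just (s≤s k≤i)) deep-b o len _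
          with split-context i b k≤i deep-b o len
        ... | q , q≤ , s =
          suc q , ≤-trans (s≤s q≤) (≤-reflexive (sym (+-suc (2 * length βs) 1))) ,
          subst (RichSplit _ _ ℓ _) (sym (++-assoc (source i p (suc ℓ)) _ _)) (here (pure k≤i) s)
        rich-split-context nothing nothing nothing nothing (none ls) len (middle ℓ∈) =
          ⊥-elim (top-absent ls ℓ∈)
        rich-split-context nothing (just zero) nothing (just ()) (none ls) len _
        rich-split-context nothing {βs} (just (suc j)) nothing (just (s≤s k≤j)) (none ls) len _ =
          1 , ≤-trans (s≤s z≤n) (m≤n+m 2 (2 * length βs)) ,
          subst (RichSplit _ _ ℓ 1) (sym (context-edge [] j βs ℓ))
            (there (rich nothing (just j) nothing (just k≤j) ls len right) (last (pure k≤j)))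
        rich-split-context nothing b nothing deep-b (next {αs} {βs} ls o) len _
          with split-context n b k≤n deep-b o (length-βs αs len)
        ... | q , q≤ , s =
          suc (suc q) , ≤-trans (count αs q≤) (+-monoʳ-≤ (2 * length (αs ++ ℓ ∷ βs)) (n≤1+n 1)) ,
          subst (RichSplit _ _ ℓ _) (sym (context-block [] αs βs (closingEdge b ℓ) ℓ))
            (there (rich nothing (just n) nothing (just k≤n) ls (length-αs αs len) right)
                   (here (pure k≤n) s))

      contexts-rich : ∀ k ℓ → k ≤ n → ContextsRich k ℓ
      contexts-rich zero ℓ k≤n a b _ _ ls len nt = length-context nt , context-levels a b ls
      contexts-rich (suc k) ℓ k<n a {βs} b deep-a deep-b ls len nt
        with rich-split-context (<⇒≤ k<n) (contexts-rich k (suc ℓ) (<⇒≤ k<n)) a b deep-a deep-b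
               (occurrences ls) len nt
      ... | q , q≤ , s =
        q , ≤-trans q≤ (≤-trans (+-monoˡ-≤ 2 (*-monoʳ-≤ 2 len)) 2N+2≤p) , s

      -- The whole word is the context without edges at level 0; a block with shift 0 makes it
      -- nontrivial.
      blocks-match : ∀ {βs} → length βs ≤ N → 0 ∈ βs → 1 ≤ p →
                     Match n (blocks βs) (target n 1 0)
      blocks-match {βs} len 0∈ 1≤p =
        subst (λ as → Match n as (target n 1 0)) (++-identityʳ (blocks βs))
          (rich-match n (+-identityʳ n)
            (contexts-rich n 0 ≤-refl nothing nothing nothing nothing
              (All.universal (λ _ → z≤n) βs) len (middle 0∈)) 1≤p)

-- Estimates by towers.

module TowerBounds where

  open Ramsey
  open import Data.Nat.Base
  open import Data.Nat.Properties
  open import Relation.Binary.PropositionalEquality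
    using (_≡_; refl; sym; trans; cong; cong₂; subst)
  open ≤-Reasoning

  hierarchy₁ : ∀ n → hierarchy 1 n ≡ 2 ^ n
  hierarchy₁ zero    = refl
  hierarchy₁ (suc n) = cong (2 *_) (hierarchy₁ n)

  f₃-suc : ∀ n → f₃ (suc n) ≡ 2 ^ f₃ n
  f₃-suc n = hierarchy₁ (f₃ n)

  n<2^n : ∀ n → n < 2 ^ n
  n<2^n zero    = s≤s z≤n
  n<2^n (suc n) = begin-strict
    suc n             ≤⟨ n<2^n n ⟩
    2 ^ n             <⟨ m<m+n (2 ^ n) (≤-trans (m^n>0 2 n) (m≤m+n _ 0)) ⟩
    2 ^ suc n         ∎

  2n≤2^n : ∀ n → n + n ≤ 2 ^ n
  2n≤2^n zero    = z≤n
  2n≤2^n (suc n) = begin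
    suc n + suc n      ≤⟨ +-mono-≤ (n<2^n n) (n<2^n n) ⟩
    2 ^ n + 2 ^ n      ≡⟨ cong (2 ^ n +_) (+-identityʳ _) ⟨
    2 ^ suc n          ∎

  f₃-step : ∀ n → f₃ n < f₃ (suc n)
  f₃-step n = subst (f₃ n <_) (sym (f₃-suc n)) (n<2^n (f₃ n))

  n<f₃n : ∀ n → n < f₃ n
  n<f₃n zero    = s≤s z≤n
  n<f₃n (suc n) = ≤-<-trans (n<f₃n n) (f₃-step n)

  f₃-mono-≤ : ∀ {m n} → m ≤′ n → f₃ m ≤ f₃ n
  f₃-mono-≤ ≤′-refl           = ≤-refl
  f₃-mono-≤ (≤′-step {n} m≤n) = ≤-trans (f₃-mono-≤ m≤n) (<⇒≤ (f₃-step n))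

  f₃-mono-< : ∀ {m n} → m < n → f₃ m < f₃ n
  f₃-mono-< {m} m<n = <-≤-trans (f₃-step m) (f₃-mono-≤ (≤⇒≤′ m<n))

  -- The factor c * c gives the induction enough room for the additive constants.
  endBound-≤ : ∀ j {c} → 2 ≤ c → (2 + endBound j c) * (c * c) ≤ c ^ (2 ^ (2 + j))
  endBound-≤ zero {c} 2≤c = begin
    2 * (c * c)          ≤⟨ *-monoˡ-≤ (c * c) (≤-trans 2≤c (m≤m*n c c {{c≢0}})) ⟩
    (c * c) * (c * c)    ≡⟨ cong₂ _*_ c² c² ⟩
    c ^ 2 * c ^ 2        ≡⟨ ^-distribˡ-+-* c 2 2 ⟨
    c ^ 4                ∎
    where
    c≢0 : NonZero c
    c≢0 = >-nonZero (≤-trans (s≤s z≤n) 2≤c)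
    c² : c * c ≡ c ^ 2
    c² = cong (c *_) (sym (*-identityʳ c))
  endBound-≤ (suc j) {c} 2≤c = begin
    (3 + c * suc B) * (c * c)
      ≤⟨ *-monoˡ-≤ (c * c) (begin
           3 + c * suc B                  ≤⟨ +-mono-≤ (≤-trans (n≤1+n 3) (*-mono-≤ 2≤c 2≤c))
                                                      (*-monoˡ-≤ (suc B) (m≤m*n c c {{c≢0}})) ⟩
           c * c + (c * c) * suc B        ≡⟨ *-suc (c * c) (suc B) ⟨
           (c * c) * (2 + B)              ≡⟨ *-comm (c * c) (2 + B) ⟩
           (2 + B) * (c * c)              ∎) ⟩
    (2 + B) * (c * c) * (c * c)
      ≡⟨ *-assoc (2 + B) (c * c) (c * c) ⟩
    (2 + B) * ((c * c) * (c * c))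
      ≤⟨ endBound-≤ j (≤-trans 2≤c (m≤m*n c c {{c≢0}})) ⟩
    (c * c) ^ (2 ^ (2 + j))
      ≡⟨ cong (λ d → (c * d) ^ (2 ^ (2 + j))) (*-identityʳ c) ⟨
    (c ^ 2) ^ (2 ^ (2 + j))
      ≡⟨ ^-*-assoc c 2 (2 ^ (2 + j)) ⟩
    c ^ (2 ^ (3 + j))
      ∎
    where
    B = endBound j (c * c)
    c≢0 : NonZero c
    c≢0 = >-nonZero (≤-trans (s≤s z≤n) 2≤c)

  -- Two of the exponentials are the growth of `endBound` in `j`; the third absorbs the additive
  -- terms through `T + T ≤ 2 ^ T`.
  endBound-tower : ∀ j T {c} → 2 ≤ c → j ≤ suc T → c + 3 ≤ T →
                   endBound j c ≤ 2 ^ (2 ^ (2 ^ T))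
  endBound-tower j T {c} 2≤c j≤ c≤ = begin
    endBound j c                      ≤⟨ m≤n+m _ 2 ⟩
    2 + endBound j c                  ≤⟨ m≤m*n _ (c * c) {{m*n≢0 c c {{c≢0}} {{c≢0}}}} ⟩
    (2 + endBound j c) * (c * c)      ≤⟨ endBound-≤ j 2≤c ⟩
    c ^ (2 ^ (2 + j))                 ≤⟨ ^-monoˡ-≤ (2 ^ (2 + j)) (<⇒≤ (n<2^n c)) ⟩
    (2 ^ c) ^ (2 ^ (2 + j))           ≡⟨ ^-*-assoc 2 c (2 ^ (2 + j)) ⟩
    2 ^ (c * 2 ^ (2 + j))             ≤⟨ ^-monoʳ-≤ 2 (begin
      c * 2 ^ (2 + j)                   ≤⟨ *-mono-≤ (<⇒≤ (n<2^n c)) (^-monoʳ-≤ 2 (+-monoʳ-≤ 2 j≤)) ⟩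
      2 ^ c * 2 ^ (3 + T)               ≡⟨ ^-distribˡ-+-* 2 c (3 + T) ⟨
      2 ^ (c + (3 + T))                 ≤⟨ ^-monoʳ-≤ 2 (begin
        c + (3 + T)                       ≡⟨ +-assoc c 3 T ⟨
        c + 3 + T                         ≤⟨ +-monoˡ-≤ T c≤ ⟩
        T + T                             ≤⟨ 2n≤2^n T ⟩
        2 ^ T                             ∎) ⟩
      2 ^ (2 ^ T)                       ∎) ⟩
    2 ^ (2 ^ (2 ^ T))                 ∎
    where
    c≢0 : NonZero c
    c≢0 = >-nonZero (≤-trans (s≤s z≤n) 2≤c)

  -- Each of the `k` steps adds three exponentials. The summand `c + 3` makes the tower exceed
  -- `c + 3` from the start, as `endBound-tower` demands.
  ramseyBound-≤ : ∀ k {c} M → 2 ≤ c → ramseyBound k c M ≤ f₃ (3 * k + (M + (c + 3)))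
  ramseyBound-≤ zero    {c} M 2≤c = ≤-trans (m≤m+n M (c + 3)) (<⇒≤ (n<f₃n _))
  ramseyBound-≤ (suc k) {c} M 2≤c = begin
    endBound (suc (ramseyBound k c M)) c
      ≤⟨ endBound-tower _ (f₃ h) 2≤c (s≤s (ramseyBound-≤ k M 2≤c))
           (≤-trans (≤-trans (m≤n+m (c + 3) M) (m≤n+m _ (3 * k))) (<⇒≤ (n<f₃n h))) ⟩
    2 ^ (2 ^ (2 ^ f₃ h))
      ≡⟨ trans (f₃-suc (2 + h)) (cong (2 ^_) (trans (f₃-suc (1 + h)) (cong (2 ^_) (f₃-suc h)))) ⟨
    f₃ (3 + h)
      ≡⟨ cong f₃ (trans (sym (+-assoc 3 (3 * k) _)) (cong (_+ (M + (c + 3))) (sym (*-suc 3 k)))) ⟩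
    f₃ (3 * suc k + (M + (c + 3)))
      ∎
    where h = 3 * k + (M + (c + 3))

  -- Raising `r` by one adds `m + 1` on the left and at least doubles the right. The first case is
  -- `6(m + 1) ≤ m³`, for `m = 3` just 24 against 27; an exponent `r + 1` would fail there.
  exponent-≤ : ∀ {m} r → 3 ≤ m → 1 ≤ r → m + 1 + (m + 1) * (4 + r) ≤ m ^ (r + 2)
  exponent-≤ {m} (suc zero) 3≤m _ = begin
    m + 1 + (m + 1) * 5    ≡⟨ *-suc (m + 1) 5 ⟨
    (m + 1) * 6            ≡⟨ *-distribʳ-+ 6 m 1 ⟩
    m * 6 + 6              ≤⟨ +-monoʳ-≤ (m * 6) (≤-trans (m≤m+n 6 3) (*-monoˡ-≤ 3 3≤m)) ⟩
    m * 6 + m * 3          ≡⟨ *-distribˡ-+ m 6 3 ⟨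
    m * 9                  ≤⟨ *-monoʳ-≤ m (*-mono-≤ 3≤m (*-mono-≤ 3≤m (≤-refl {1}))) ⟩
    m ^ 3                  ∎
  exponent-≤ {m} (suc (suc r)) 3≤m _ = begin
    m + 1 + (m + 1) * (4 + suc (suc r))           ≡⟨ cong (m + 1 +_) (*-suc (m + 1) (5 + r)) ⟩
    m + 1 + (m + 1 + (m + 1) * (5 + r))           ≤⟨ +-mono-≤ (m≤m+n (m + 1) _) (exponent-≤ (suc r) 3≤m (s≤s z≤n)) ⟩
    m + 1 + (m + 1) * (5 + r) + m ^ (suc r + 2)   ≤⟨ +-monoˡ-≤ _ (exponent-≤ (suc r) 3≤m (s≤s z≤n)) ⟩
    m ^ (suc r + 2) + m ^ (suc r + 2)             ≡⟨ cong (m ^ (suc r + 2) +_) (+-identityʳ _) ⟨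
    2 * m ^ (suc r + 2)                           ≤⟨ *-monoˡ-≤ (m ^ (suc r + 2)) (≤-trans (n≤1+n 2) 3≤m) ⟩
    m ^ (suc (suc r) + 2)                         ∎

  -- This is the requirement `2 * m + 2 ≤ p` for `1 + p = 2 ^ (m + 1)`.
  3≤m⇒2m+3≤2^[1+m] : ∀ {m} → 3 ≤ m → 2 * m + 3 ≤ 2 ^ (m + 1)
  3≤m⇒2m+3≤2^[1+m] {m} 3≤m with ≤⇒≤′ 3≤m
  ... | ≤′-refl           = m≤m+n 9 7
  ... | ≤′-step {m} 3≤′m  = begin
    2 * suc m + 3              ≡⟨ cong (_+ 3) (*-suc 2 m) ⟩
    2 + (2 * m + 3)            ≤⟨ +-monoʳ-≤ 2 ih ⟩
    2 + 2 ^ (m + 1)            ≤⟨ +-monoˡ-≤ _ (≤-trans (m≤n+m 2 (2 * m + 1)) (≤-trans (≤-reflexive (+-assoc (2 * m) 1 2)) ih)) ⟩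
    2 ^ (m + 1) + 2 ^ (m + 1)  ≡⟨ cong (2 ^ (m + 1) +_) (+-identityʳ _) ⟨
    2 ^ (suc m + 1)            ∎
    where
    ih : 2 * m + 3 ≤ 2 ^ (m + 1)
    ih = 3≤m⇒2m+3≤2^[1+m] (≤′⇒≤ 3≤′m)

  -- K and L are the lengths of a block and of the target; see Words with 1 + p = 2 ^ (m + 1).
  size-< : ∀ {m c l K L} r → 3 ≤ m → 1 ≤ r → 2 ≤ c → 1 ≤ l →
    K ≤ (2 ^ (m + 1)) ^ (4 + r) → L ≤ 2 * (2 ^ (m + 1)) ^ r →
    3 * L + (m * K + (c + 3)) < m ^ (r + 2) * c ^ (m ^ (r + 2)) * l
  size-< {m} {c} {l} {K} {L} r 3≤m 1≤r 2≤c 1≤l K≤ L≤ = begin-strict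
    3 * L + (m * K + (c + 3))            ≡⟨ +-assoc (3 * L) (m * K) (c + 3) ⟨
    3 * L + m * K + (c + 3)              ≤⟨ +-monoˡ-≤ (c + 3) (+-mono-≤ L-bound K-bound) ⟩
    X + X + (c + 3)                      ≤⟨ +-monoˡ-≤ (c + 3) (≤-reflexive (cong (X +_) (sym (+-identityʳ X)))) ⟩
    2 ^ suc e + (c + 3)                  ≤⟨ +-monoˡ-≤ (c + 3) (^-monoʳ-≤ 2 e<N) ⟩
    2 ^ N + (c + 3)                      ≤⟨ +-mono-≤ (^-monoˡ-≤ N 2≤c) (+-mono-≤ c≤c^N 3≤c^N) ⟩
    c ^ N + (c ^ N + c ^ N)              ≡⟨ cong (λ x → c ^ N + (c ^ N + x)) (+-identityʳ _) ⟨
    3 * c ^ N                            <⟨ *-monoˡ-< (c ^ N) {{m^n≢0 c N {{c≢0}}}} 4≤N ⟩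
    N * c ^ N                            ≡⟨ *-identityʳ _ ⟨
    N * c ^ N * 1                        ≤⟨ *-monoʳ-≤ (N * c ^ N) 1≤l ⟩
    N * c ^ N * l                        ∎
    where
    N = m ^ (r + 2)
    -- The first summand pays for the factor `m` of `K` and, since `6 ≤ 2 ^ m`, for the factor 6 in
    -- the bound of `3 * L`.
    e = m + (m + 1) * (4 + r)
    X = 2 ^ e
    c≢0 : NonZero c
    c≢0 = >-nonZero (≤-trans (s≤s z≤n) 2≤c)
    e<N : suc e ≤ N
    e<N = ≤-trans (≤-reflexive (trans (sym (+-comm e 1))
            (trans (+-assoc m _ 1) (trans (cong (m +_) (+-comm _ 1)) (sym (+-assoc m 1 _))))))
            (exponent-≤ r 3≤m 1≤r)
    4≤N : 4 ≤ N
    4≤N = ≤-trans (s≤s (≤-trans 3≤m (m≤m+n m _))) e<N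
    1≤N : 1 ≤ N
    1≤N = ≤-trans (s≤s z≤n) 4≤N
    c≤c^N : c ≤ c ^ N
    c≤c^N = ≤-trans (≤-reflexive (sym (*-identityʳ c))) (^-monoʳ-≤ c {{c≢0}} 1≤N)
    3≤c^N : 3 ≤ c ^ N
    3≤c^N = ≤-trans (<⇒≤ 4≤N) (≤-trans (<⇒≤ (n<2^n N)) (^-monoˡ-≤ N 2≤c))
    2^m+1 : ∀ i → (2 ^ (m + 1)) ^ i ≡ 2 ^ ((m + 1) * i)
    2^m+1 = ^-*-assoc 2 (m + 1)
    K-bound : m * K ≤ X
    K-bound = begin
      m * K                                ≤⟨ *-mono-≤ (<⇒≤ (n<2^n m)) K≤ ⟩
      2 ^ m * (2 ^ (m + 1)) ^ (4 + r)      ≡⟨ cong (2 ^ m *_) (2^m+1 (4 + r)) ⟩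
      2 ^ m * 2 ^ ((m + 1) * (4 + r))      ≡⟨ ^-distribˡ-+-* 2 m _ ⟨
      X                                    ∎
    L-bound : 3 * L ≤ X
    L-bound = begin
      3 * L                                ≤⟨ *-monoʳ-≤ 3 L≤ ⟩
      3 * (2 * (2 ^ (m + 1)) ^ r)          ≡⟨ *-assoc 3 2 ((2 ^ (m + 1)) ^ r) ⟨
      6 * (2 ^ (m + 1)) ^ r                ≤⟨ *-mono-≤ (≤-trans (m≤m+n 6 2) (^-monoʳ-≤ 2 3≤m))
                                                (^-monoʳ-≤ (2 ^ (m + 1)) {{m^n≢0 2 (m + 1)}} (m≤n+m r 4)) ⟩
      2 ^ m * (2 ^ (m + 1)) ^ (4 + r)      ≡⟨ cong (2 ^ m *_) (2^m+1 (4 + r)) ⟩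
      2 ^ m * 2 ^ ((m + 1) * (4 + r))      ≡⟨ ^-distribˡ-+-* 2 m _ ⟨
      X                                    ∎

-- Ordered field arithmetic and logarithms.

module OrderedField (em : ExcludedMiddle 0ℓ) (R : Reals) where

  open Reals R public
  open Algebra.Properties.Ring ring public
    using (-‿distribʳ-*; -‿+-comm; -‿involutive; -0#≈0#)
  open Algebra.Properties.Semiring.Exp semiring public using (_^_; ^-homo-*)
  open Algebra.Properties.Semiring.Mult semiring public
    using (×-homo-+)
  open Algebra.Properties.Semiring.Mult.TCOptimised semiring public using (×ᵤ≈×) renaming (_×_ to _·′_)
  open Algebra.Solver.Ring.NaturalCoefficients.Default commutativeSemiring public
    using (solve; _:+_; _:*_; _:=_; con)
  open TotalOrder totalOrder public using (poset; total; antisym)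
    renaming (refl to ≤-refl; trans to ≤-trans; reflexive to ≤-reflexive)
  open Relation.Binary.Properties.TotalOrder totalOrder public using (<⇒≱; ≰⇒>)
  open Relation.Binary.Reasoning.PartialOrder poset public
  open MaxOp (MaxOf.maxOperator totalOrder) public
    using (x≤x⊔y; x≤y⊔x; ⊔-lub)

  <⇒≤ : ∀ {x y} → x < y → x ≤ y
  <⇒≤ = proj₁

  ≤-respʳ : ∀ {x y z} → y ≈ z → x ≤ y → x ≤ z
  ≤-respʳ y≈z x≤y = ≤-trans x≤y (≤-reflexive y≈z)

  ≤-respˡ : ∀ {x y z} → y ≈ z → y ≤ x → z ≤ x
  ≤-respˡ y≈z y≤x = ≤-trans (≤-reflexive (sym y≈z)) y≤x

  +-mono-≤ : ∀ {w x y z} → w ≤ x → y ≤ z → w + y ≤ x + z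
  +-mono-≤ {w} {x} {y} {z} w≤x y≤z = begin
    w + y ≤⟨ +-monoʳ-≤ w y≤z ⟩
    w + z ≈⟨ +-comm w z ⟩
    z + w ≤⟨ +-monoʳ-≤ z w≤x ⟩
    z + x ≈⟨ +-comm z x ⟩
    x + z ∎

  +-monoˡ-≤ : ∀ x {y z} → y ≤ z → y + x ≤ z + x
  +-monoˡ-≤ x y≤z = +-mono-≤ y≤z ≤-refl

  x+y-y≈x : ∀ x y → x + y - y ≈ x
  x+y-y≈x x y = begin-equality
    x + y - y     ≈⟨ +-assoc x y (- y) ⟩
    x + (y - y)   ≈⟨ +-congˡ (-‿inverseʳ y) ⟩
    x + 0#        ≈⟨ +-identityʳ x ⟩
    x             ∎

  x-y+y≈x : ∀ x y → x - y + y ≈ x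
  x-y+y≈x x y = begin-equality
    x - y + y       ≈⟨ +-assoc x (- y) y ⟩
    x + (- y + y)   ≈⟨ +-congˡ (-‿inverseˡ y) ⟩
    x + 0#          ≈⟨ +-identityʳ x ⟩
    x               ∎

  x≤z+y⇒x-y≤z : ∀ {x y z} → x ≤ z + y → x - y ≤ z
  x≤z+y⇒x-y≤z {x} {y} {z} le = ≤-respʳ (x+y-y≈x z y) (+-monoˡ-≤ (- y) le)

  x-y≤z⇒x≤z+y : ∀ {x y z} → x - y ≤ z → x ≤ z + y
  x-y≤z⇒x≤z+y {x} {y} {z} le = ≤-respˡ (x-y+y≈x x y) (+-monoˡ-≤ y le)

  x≤z-y⇒x+y≤z : ∀ {x y z} → x ≤ z - y → x + y ≤ z
  x≤z-y⇒x+y≤z {x} {y} {z} le = ≤-respʳ (x-y+y≈x z y) (+-monoˡ-≤ y le)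

  x+y≤z⇒x≤z-y : ∀ {x y z} → x + y ≤ z → x ≤ z - y
  x+y≤z⇒x≤z-y {x} {y} {z} le = ≤-respˡ (x+y-y≈x x y) (+-monoˡ-≤ (- y) le)

  +-cancelʳ-≤ : ∀ z {x y} → x + z ≤ y + z → x ≤ y
  +-cancelʳ-≤ z {x} {y} le = ≤-respʳ (x+y-y≈x y z) (x+y≤z⇒x≤z-y le)

  +-monoˡ-< : ∀ z {x y} → x < y → x + z < y + z
  +-monoˡ-< z {x} {y} (x≤y , x≉y) = +-monoˡ-≤ z x≤y , λ eq → x≉y (begin-equality
    x          ≈⟨ x+y-y≈x x z ⟨
    x + z - z  ≈⟨ +-congʳ eq ⟩
    y + z - z  ≈⟨ x+y-y≈x y z ⟩
    y          ∎)

  x≤y⇒0≤y-x : ∀ {x y} → x ≤ y → 0# ≤ y - x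
  x≤y⇒0≤y-x {x} x≤y = x+y≤z⇒x≤z-y (≤-respˡ (sym (+-identityˡ x)) x≤y)

  0≤y-x⇒x≤y : ∀ {x y} → 0# ≤ y - x → x ≤ y
  0≤y-x⇒x≤y {x} le = ≤-respˡ (+-identityˡ x) (x≤z-y⇒x+y≤z le)

  -‿anti-≤ : ∀ {x y} → x ≤ y → - y ≤ - x
  -‿anti-≤ {x} {y} x≤y = 0≤y-x⇒x≤y (begin
    0#            ≤⟨ x≤y⇒0≤y-x x≤y ⟩
    y - x         ≈⟨ +-comm y (- x) ⟩
    - x + y       ≈⟨ +-congˡ (-‿involutive y) ⟨
    - x - - y     ∎)

  x≤0⇒0≤-x : ∀ {x} → x ≤ 0# → 0# ≤ - x
  x≤0⇒0≤-x x≤0 = ≤-respˡ -0#≈0# (-‿anti-≤ x≤0)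

  *-monoˡ-≤ : ∀ z {x y} → 0# ≤ z → x ≤ y → z * x ≤ z * y
  *-monoˡ-≤ z {x} {y} 0≤z x≤y = 0≤y-x⇒x≤y (begin
    0#                ≤⟨ *-nonNeg 0≤z (x≤y⇒0≤y-x x≤y) ⟩
    z * (y - x)       ≈⟨ distribˡ z y (- x) ⟩
    z * y + z * - x   ≈⟨ +-congˡ (-‿distribʳ-* z x) ⟨
    z * y - z * x     ∎)

  *-monoʳ-≤ : ∀ z {x y} → 0# ≤ z → x ≤ y → x * z ≤ y * z
  *-monoʳ-≤ z {x} {y} 0≤z x≤y = begin
    x * z   ≈⟨ *-comm x z ⟩
    z * x   ≤⟨ *-monoˡ-≤ z 0≤z x≤y ⟩
    z * y   ≈⟨ *-comm z y ⟩
    y * z   ∎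

  *-mono-≤ : ∀ {w x y z} → 0# ≤ w → 0# ≤ z → w ≤ x → y ≤ z → w * y ≤ x * z
  *-mono-≤ {w} {z = z} 0≤w 0≤z w≤x y≤z = ≤-trans (*-monoˡ-≤ w 0≤w y≤z) (*-monoʳ-≤ z 0≤z w≤x)

  0≤1 : 0# ≤ 1#
  0≤1 with total 0# 1#
  ... | inj₁ le = le
  ... | inj₂ 1≤0 = begin
    0#            ≤⟨ *-nonNeg (x≤0⇒0≤-x 1≤0) (x≤0⇒0≤-x 1≤0) ⟩
    - 1# * - 1#   ≈⟨ -‿distribʳ-* (- 1#) 1# ⟨
    - (- 1# * 1#) ≈⟨ -‿cong (*-identityʳ (- 1#)) ⟩
    - - 1#        ≈⟨ -‿involutive 1# ⟩
    1#            ∎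

  0<1 : 0# < 1#
  0<1 = 0≤1 , 0≉1

  *-pos : ∀ {x y} → 0# < x → 0# < y → 0# < x * y
  *-pos {x} {y} (0≤x , 0≉x) (0≤y , 0≉y) = *-nonNeg 0≤x 0≤y , λ 0≈xy → 0≉y (begin-equality
    0#              ≈⟨ zeroˡ (x ⁻¹) ⟨
    0# * x ⁻¹       ≈⟨ *-congʳ 0≈xy ⟩
    x * y * x ⁻¹    ≈⟨ *-congʳ (*-comm x y) ⟩
    y * x * x ⁻¹    ≈⟨ *-assoc y x (x ⁻¹) ⟩
    y * (x * x ⁻¹)  ≈⟨ *-congˡ (*-inverseʳ x (λ x≈0 → 0≉x (sym x≈0))) ⟩
    y * 1#          ≈⟨ *-identityʳ y ⟩
    y               ∎)

  pos⇒≉0 : ∀ {x} → 0# < x → ¬ (x ≈ 0#)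
  pos⇒≉0 (_ , 0≉x) x≈0 = 0≉x (sym x≈0)

  x*[y÷x]≈y : ∀ {x} y → 0# < x → x * (y ÷ x) ≈ y
  x*[y÷x]≈y {x} y 0<x = begin-equality
    x * (y * x ⁻¹)  ≈⟨ *-congˡ (*-comm y (x ⁻¹)) ⟩
    x * (x ⁻¹ * y)  ≈⟨ *-assoc x (x ⁻¹) y ⟨
    x * x ⁻¹ * y    ≈⟨ *-congʳ (*-inverseʳ x (pos⇒≉0 0<x)) ⟩
    1# * y          ≈⟨ *-identityˡ y ⟩
    y               ∎

  -- If `y ≤ x`, the two products are equal by antisymmetry, and an equality can be multiplied by
  -- `z ⁻¹` before anything is known about its sign; positivity of quotients is deduced from this
  -- lemma.
  *-cancelˡ-≤ : ∀ {z x y} → 0# < z → z * x ≤ z * y → x ≤ y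
  *-cancelˡ-≤ {z} {x} {y} 0<z le with total x y
  ... | inj₁ x≤y = x≤y
  ... | inj₂ y≤x = ≤-reflexive (begin-equality
    x               ≈⟨ *-identityˡ x ⟨
    1# * x          ≈⟨ *-congʳ (trans (*-comm (z ⁻¹) z) (*-inverseʳ z (pos⇒≉0 0<z))) ⟨
    z ⁻¹ * z * x    ≈⟨ *-assoc (z ⁻¹) z x ⟩
    z ⁻¹ * (z * x)  ≈⟨ *-congˡ (antisym le (*-monoˡ-≤ z (<⇒≤ 0<z) y≤x)) ⟩
    z ⁻¹ * (z * y)  ≈⟨ *-assoc (z ⁻¹) z y ⟨
    z ⁻¹ * z * y    ≈⟨ *-congʳ (trans (*-comm (z ⁻¹) z) (*-inverseʳ z (pos⇒≉0 0<z))) ⟩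
    1# * y          ≈⟨ *-identityˡ y ⟩
    y               ∎)

  *-cancelˡ : ∀ {z x y} → 0# < z → z * x ≈ z * y → x ≈ y
  *-cancelˡ 0<z eq = antisym (*-cancelˡ-≤ 0<z (≤-reflexive eq))
                             (*-cancelˡ-≤ 0<z (≤-reflexive (sym eq)))

  *-monoˡ-< : ∀ {z x y} → 0# < z → x < y → z * x < z * y
  *-monoˡ-< {z} 0<z (x≤y , x≉y) =
    *-monoˡ-≤ z (<⇒≤ 0<z) x≤y , λ eq → x≉y (*-cancelˡ 0<z eq)

  *-cancelˡ-< : ∀ {z x y} → 0# < z → z * x < z * y → x < y
  *-cancelˡ-< {z} 0<z lt = *-cancelˡ-≤ 0<z (<⇒≤ lt) , λ x≈y → proj₂ lt (*-congˡ x≈y)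

  ÷-pos : ∀ {x y} → 0# < x → 0# < y → 0# < y ÷ x
  ÷-pos {x} {y} 0<x 0<y = *-cancelˡ-< 0<x (begin-strict
    x * 0#       ≈⟨ zeroʳ x ⟩
    0#           <⟨ 0<y ⟩
    y            ≈⟨ x*[y÷x]≈y y 0<x ⟨
    x * (y ÷ x)  ∎)

  x≤x+y : ∀ x {y} → 0# ≤ y → x ≤ x + y
  x≤x+y x 0≤y = ≤-respˡ (+-identityʳ x) (+-monoʳ-≤ x 0≤y)

  fromℕ-nonNeg : ∀ n → 0# ≤ fromℕ n
  fromℕ-nonNeg zero    = ≤-refl
  fromℕ-nonNeg (suc n) = ≤-trans 0≤1 (x≤x+y 1# (fromℕ-nonNeg n))

  fromℕ-pos : ∀ n → 0# < fromℕ (suc n)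
  fromℕ-pos n = begin-strict
    0#             <⟨ 0<1 ⟩
    1#             ≤⟨ x≤x+y 1# (fromℕ-nonNeg n) ⟩
    fromℕ (suc n)  ∎

  ∣x∣≤y : ∀ {x y} → x ≤ y → - x ≤ y → ∣ x ∣ ≤ y
  ∣x∣≤y = ⊔-lub

  x≤∣x∣ : ∀ x → x ≤ ∣ x ∣
  x≤∣x∣ x = x≤x⊔y x (- x)

  -x≤∣x∣ : ∀ x → - x ≤ ∣ x ∣
  -x≤∣x∣ x = x≤y⊔x x (- x)

  -[x-y]≈y-x : ∀ x y → - (x - y) ≈ y - x
  -[x-y]≈y-x x y = begin-equality
    - (x - y)     ≈⟨ -‿+-comm x (- y) ⟨
    - x - - y     ≈⟨ +-congˡ (-‿involutive y) ⟩
    - x + y       ≈⟨ +-comm (- x) y ⟩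
    y - x         ∎

  ∣x-y∣≤z : ∀ {x y z} → x ≤ z + y → y ≤ z + x → ∣ x - y ∣ ≤ z
  ∣x-y∣≤z {x} {y} x≤ y≤ =
    ∣x∣≤y (x≤z+y⇒x-y≤z x≤) (≤-respˡ (sym (-[x-y]≈y-x x y)) (x≤z+y⇒x-y≤z y≤))

  ∣x-y∣≤z⇒x≤z+y : ∀ {x y z} → ∣ x - y ∣ ≤ z → x ≤ z + y
  ∣x-y∣≤z⇒x≤z+y {x} {y} le = x-y≤z⇒x≤z+y (≤-trans (x≤∣x∣ (x - y)) le)

  ∣x-y∣≤z⇒y≤z+x : ∀ {x y z} → ∣ x - y ∣ ≤ z → y ≤ z + x
  ∣x-y∣≤z⇒y≤z+x {x} {y} le =
    x-y≤z⇒x≤z+y (≤-trans (≤-respˡ (-[x-y]≈y-x x y) (-x≤∣x∣ (x - y))) le)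

  interval : ∀ {a b d x y} → b ≤ d + a → a ≤ x → x ≤ b → a ≤ y → y ≤ b → ∣ x - y ∣ ≤ d
  interval {d = d} b≤ a≤x x≤b a≤y y≤b =
    ∣x-y∣≤z (≤-trans x≤b (≤-trans b≤ (+-monoʳ-≤ d a≤y)))
            (≤-trans y≤b (≤-trans b≤ (+-monoʳ-≤ d a≤x)))

  ^-nonNeg : ∀ {x} n → 0# ≤ x → 0# ≤ x ^ n
  ^-nonNeg zero    0≤x = 0≤1
  ^-nonNeg (suc n) 0≤x = *-nonNeg 0≤x (^-nonNeg n 0≤x)

  ^-pos : ∀ {x} n → 0# < x → 0# < x ^ n
  ^-pos zero    0<x = 0<1
  ^-pos (suc n) 0<x = *-pos 0<x (^-pos n 0<x)

  ^-anti-≤ : ∀ {x m n} → 0# ≤ x → x ≤ 1# → m ℕ.≤ n → x ^ n ≤ x ^ m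
  ^-anti-≤ {n = zero}  0≤x x≤1 z≤n = ≤-refl
  ^-anti-≤ {x} {n = suc n} 0≤x x≤1 z≤n = begin
    x * x ^ n   ≤⟨ *-monoʳ-≤ (x ^ n) (^-nonNeg n 0≤x) x≤1 ⟩
    1# * x ^ n  ≈⟨ *-identityˡ (x ^ n) ⟩
    x ^ n       ≤⟨ ^-anti-≤ {n = n} 0≤x x≤1 z≤n ⟩
    1#          ∎
  ^-anti-≤ {x} 0≤x x≤1 (s≤s le) = *-monoˡ-≤ x 0≤x (^-anti-≤ 0≤x x≤1 le)

  module Logarithm {log : ℝ → ℝ} (isLog : IsLogarithm log) where

    open IsLogarithm isLog

    log-1 : log 1# ≈ 0#
    log-1 = begin-equality
      log 1#                      ≈⟨ x+y-y≈x (log 1#) (log 1#) ⟨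
      log 1# + log 1# - log 1#    ≈⟨ +-congʳ (log-* 0<1 0<1) ⟨
      log (1# * 1#) - log 1#      ≈⟨ +-congʳ (log-cong (*-pos 0<1 0<1) (*-identityˡ 1#)) ⟩
      log 1# - log 1#             ≈⟨ -‿inverseʳ (log 1#) ⟩
      0#                          ∎

    log-pos : ∀ {x} → 1# < x → 0# < log x
    log-pos {x} 1<x = begin-strict
      0#      ≈⟨ log-1 ⟨
      log 1#  <⟨ log-mono 0<1 1<x ⟩
      log x   ∎

    log-^ : ∀ {x} n → 0# < x → log (x ^ n) ≈ fromℕ n * log x
    log-^ {x} zero    0<x = trans log-1 (sym (zeroˡ (log x)))
    log-^ {x} (suc n) 0<x = begin-equality
      log (x * x ^ n)             ≈⟨ log-* 0<x (^-pos n 0<x) ⟩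
      log x + log (x ^ n)         ≈⟨ +-congˡ (log-^ n 0<x) ⟩
      log x + fromℕ n * log x     ≈⟨ +-congʳ (*-identityˡ (log x)) ⟨
      1# * log x + fromℕ n * log x ≈⟨ distribʳ (log x) 1# (fromℕ n) ⟨
      (1# + fromℕ n) * log x      ∎

    log-÷-pos : ∀ {x y} → 1# < x → 1# < y → 0# < log x ÷ log y
    log-÷-pos 1<x 1<y = ÷-pos (log-pos 1<y) (log-pos 1<x)

    -- Since `log y` is negative, clearing the denominator reverses the inequality; the computation
    -- multiplies by `- log y` instead. The result contradicts the monotonicity of `log` if
    -- `x < y ^ n`.
    ^-≤-of-log : ∀ {x y} n → 0# < x → 0# < y → y < 1# →
                 log x ÷ log y ≤ fromℕ n → y ^ n ≤ x
    ^-≤-of-log {x} {y} n 0<x 0<y y<1 le with em {y ^ n ≤ x}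
    ... | yes yⁿ≤x = yⁿ≤x
    ... | no  yⁿ≰x = ⊥-elim (<⇒≱ (log-mono 0<x (≰⇒> yⁿ≰x)) (≤-respˡ (sym (log-^ n 0<y)) nb≤a))
      where
      a = log x
      b = log y
      0<-b : 0# < - b
      0<-b = x≤0⇒0≤-x (<⇒≤ b<0) , λ 0≈-b → proj₂ b<0
        (trans (sym (-‿involutive b)) (trans (-‿cong (sym 0≈-b)) -0#≈0#))
        where
        b<0 : b < 0#
        b<0 = begin-strict
          b       <⟨ log-mono 0<y y<1 ⟩
          log 1#  ≈⟨ log-1 ⟩
          0#      ∎
      b≉0 : ¬ (b ≈ 0#)
      b≉0 b≈0 = proj₂ 0<-b (sym (trans (-‿cong b≈0) -0#≈0#))
      nb≤a : fromℕ n * b ≤ a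
      nb≤a = ≤-respʳ (-‿involutive a) (≤-respˡ (-‿involutive (fromℕ n * b)) (-‿anti-≤ (begin
        - a                   ≈⟨ -‿cong (*-identityʳ a) ⟨
        - (a * 1#)            ≈⟨ -‿cong (*-congˡ (trans (*-comm (b ⁻¹) b) (*-inverseʳ b b≉0))) ⟨
        - (a * (b ⁻¹ * b))    ≈⟨ -‿cong (*-assoc a (b ⁻¹) b) ⟨
        - (a ÷ b * b)         ≈⟨ -‿distribʳ-* (a ÷ b) b ⟩
        a ÷ b * - b           ≤⟨ *-monoʳ-≤ (- b) (<⇒≤ 0<-b) le ⟩
        fromℕ n * - b         ≈⟨ -‿distribʳ-* (fromℕ n) b ⟨
        - (fromℕ n * b)       ∎)))

-- Vectors with prescribed values at prescribed positions.

module Vectors (em : ExcludedMiddle 0ℓ) (R : Reals) where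

  open Patterns

  open OrderedField em R

  ≤‖‖ : ∀ {n} (x : Vector ℝ n) i → ∣ x i ∣ ≤ ‖ x ‖
  ≤‖‖ x Fin.zero    = x≤x⊔y _ _
  ≤‖‖ x (Fin.suc i) = ≤-trans (≤‖‖ (x ∘ Fin.suc) i) (x≤y⊔x _ _)

  ‖‖-lub : ∀ {n} (x : Vector ℝ n) {b} → 0# ≤ b → (∀ i → ∣ x i ∣ ≤ b) → ‖ x ‖ ≤ b
  ‖‖-lub {zero}  x 0≤b le = 0≤b
  ‖‖-lub {suc n} x 0≤b le = ⊔-lub (le Fin.zero) (‖‖-lub (x ∘ Fin.suc) 0≤b (le ∘ Fin.suc))

  Unit : Pred ℝ 0ℓ
  Unit x = 0# ≤ x × x ≤ 1#

  PS-unit : ∀ {n Y} {x : Vector ℝ n} → PS Y x → ∀ i → Unit (x i)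
  PS-unit {x = x} (_ , 0≤x , norm) i =
    0≤x i , ≤-trans (x≤∣x∣ (x i)) (≤-respʳ norm (≤‖‖ x i))

  ∣∣-unit : ∀ {x y} → Unit x → Unit y → ∣ x - y ∣ ≤ 1#
  ∣∣-unit (0≤x , x≤1) (0≤y , y≤1) =
    interval (≤-reflexive (sym (+-identityʳ 1#))) 0≤x x≤1 0≤y y≤1

  PS-diameter : ∀ {n Y Z} {x y : Vector ℝ n} → PS Y x → PS Z y → ‖ x ⊖ y ‖ ≤ 1#
  PS-diameter {Y = Y} {Z} {x} {y} px py =
    ‖‖-lub (x ⊖ y) 0≤1 (λ i → ∣∣-unit (PS-unit {Y = Y} px i) (PS-unit {Y = Z} py i))

  unit-PS : ∀ {n} {Y : Pred (Vector ℝ n) 0ℓ} {x} → Y x → (∀ i → Unit (x i)) →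
            ∃ (λ i → x i ≈ 1#) → PS Y x
  unit-PS {x = x} yx unit (i , xᵢ≈1) = yx , proj₁ ∘ unit , antisym
    (‖‖-lub x 0≤1 (λ j → ∣x∣≤y (proj₂ (unit j))
      (≤-trans (≤-respʳ -0#≈0# (-‿anti-≤ (proj₁ (unit j)))) 0≤1)))
    (≤-trans (≤-respˡ xᵢ≈1 (x≤∣x∣ (x i))) (≤‖‖ x i))

  spike : ∀ {n} → Fin n → ℝ → Vector ℝ n
  spike h v i with i Fin.≟ h
  ... | yes _ = v
  ... | no  _ = 0#

  -- Σₖ vₖ e_{hₖ}
  place : ∀ {n} → List (Fin n) → List ℝ → Vector ℝ n
  place []       vs       i = 0#
  place (h ∷ hs) []       i = 0#
  place (h ∷ hs) (v ∷ vs) i = spike h v i + place hs vs i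

  spike-hit : ∀ {n} (h : Fin n) v → spike h v h ≈ v
  spike-hit h v with h Fin.≟ h
  ... | yes _   = refl
  ... | no  h≢h = ⊥-elim (h≢h ≡.refl)

  spike-miss : ∀ {n} {h : Fin n} {v i} → i ≢ h → spike h v i ≈ 0#
  spike-miss {h = h} {i = i} i≢h with i Fin.≟ h
  ... | yes i≡h = ⊥-elim (i≢h i≡h)
  ... | no  _   = refl

  spike-scale : ∀ {n} c (h : Fin n) v i → c * spike h v i ≈ spike h (c * v) i
  spike-scale c h v i with i Fin.≟ h
  ... | yes _ = refl
  ... | no  _ = zeroʳ c

  place-++ : ∀ {n} (hs : List (Fin n)) {hs′} vs {vs′} → length hs ≡ length vs → ∀ i →
             place hs vs i + place hs′ vs′ i ≈ place (hs ++ hs′) (vs ++ vs′) i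
  place-++ []       []       _  i = +-identityˡ _
  place-++ (h ∷ hs) (v ∷ vs) eq i =
    trans (+-assoc _ _ _) (+-congˡ (place-++ hs vs (ℕ.suc-injective eq) i))

  place-scale : ∀ {n} c (hs : List (Fin n)) vs i →
                c * place hs vs i ≈ place hs (List.map (c *_) vs) i
  place-scale c []       vs       i = zeroʳ c
  place-scale c (h ∷ hs) []       i = zeroʳ c
  place-scale c (h ∷ hs) (v ∷ vs) i =
    trans (distribˡ c _ _) (+-cong (spike-scale c h v i) (place-scale c hs vs i))

  place-outside : ∀ {n} {hs : List (Fin n)} vs {i} → All (i ≢_) hs → place hs vs i ≈ 0#
  place-outside vs       []           = refl
  place-outside []       (_ ∷ _)      = refl
  place-outside (v ∷ vs) (i≢h ∷ i≢hs) =
    trans (+-cong (spike-miss i≢h) (place-outside vs i≢hs)) (+-identityˡ 0#)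

  place-support : ∀ {n} (hs : List (Fin n)) vs {i} → ¬ (place hs vs i ≈ 0#) → i ∈ hs
  place-support []       vs       ≉0 = ⊥-elim (≉0 refl)
  place-support (h ∷ hs) []       ≉0 = ⊥-elim (≉0 refl)
  place-support (h ∷ hs) (v ∷ vs) {i} ≉0 with i Fin.≟ h
  ... | yes i≡h = here i≡h
  ... | no  _   = there (place-support hs vs (λ ≈0 → ≉0 (trans (+-identityˡ _) ≈0)))

  Sorted : ∀ {n} → List (Fin n) → Set
  Sorted = AllPairs Fin._<_

  Sorted-⊆ : ∀ {n} {is js : List (Fin n)} → is ⊆ js → Sorted js → Sorted is
  Sorted-⊆ []             []             = []
  Sorted-⊆ (_ ∷ʳ is⊆)     (_ ∷ sorted)   = Sorted-⊆ is⊆ sorted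
  Sorted-⊆ (≡.refl ∷ is⊆) (lts ∷ sorted) = All-resp-⊆ is⊆ lts ∷ Sorted-⊆ is⊆ sorted

  allFin-sorted : ∀ n → Sorted (List.allFin n)
  allFin-sorted n = AllPairs.tabulate⁺-< (λ i<j → i<j)

  ≢-head : ∀ {n} {h : Fin n} {hs} → All (h Fin.<_) hs → All (h ≢_) hs
  ≢-head = All.map Fin.<⇒≢

  place-head : ∀ {n} {h : Fin n} {hs v} vs → All (h Fin.<_) hs → place (h ∷ hs) (v ∷ vs) h ≈ v
  place-head {h = h} {v = v} vs lts =
    trans (+-cong (spike-hit h v) (place-outside vs (≢-head lts))) (+-identityʳ v)

  place-tail : ∀ {n} {h : Fin n} hs {v} vs {i} → i ≢ h →
               place (h ∷ hs) (v ∷ vs) i ≈ place hs vs i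
  place-tail hs vs i≢h = trans (+-congʳ (spike-miss i≢h)) (+-identityˡ _)

  module _ {P : Pred ℝ 0ℓ} (resp : ∀ {x y} → x ≈ y → P x → P y) where

    place-All : ∀ {n} {hs : List (Fin n)} {vs} → P 0# → Sorted hs → All P vs →
                ∀ i → P (place hs vs i)
    place-All {hs = []}     P0 _ _  i = P0
    place-All {hs = h ∷ hs} P0 _ [] i = P0
    place-All {hs = h ∷ hs} {v ∷ vs} P0 (lts ∷ sorted) (pv ∷ pvs) i with em {i ≡ h}
    ... | yes ≡.refl = resp (sym (place-head vs lts)) pv
    ... | no  i≢h    = resp (sym (place-tail hs vs i≢h)) (place-All P0 sorted pvs i)

    place-Any : ∀ {n} {hs : List (Fin n)} {vs} → Sorted hs → length hs ≡ length vs →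
                Any P vs → ∃ λ i → i ∈ hs × P (place hs vs i)
    place-Any {hs = h ∷ hs} {v ∷ vs} (lts ∷ _) eq (here pv) =
      h , here ≡.refl , resp (sym (place-head vs lts)) pv
    place-Any {hs = h ∷ hs} {v ∷ vs} (lts ∷ sorted) eq (there pvs)
      with place-Any sorted (ℕ.suc-injective eq) pvs
    ... | i , i∈ , pi =
      i , there i∈ , resp (sym (place-tail hs vs (λ i≡h → All.lookup (≢-head lts) i∈ (≡.sym i≡h)))) pi

    place-All⁻ : ∀ {n} {hs : List (Fin n)} {vs} → Sorted hs → length hs ≡ length vs →
                 (∀ i → P (place hs vs i)) → All P vs
    place-All⁻ {hs = []}     {[]}     _                _  p = []
    place-All⁻ {hs = h ∷ hs} {v ∷ vs} (lts ∷ sorted) eq p =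
      resp (place-head vs lts) (p h) ∷ All.tabulate (λ {w} w∈ →
        let i , i∈ , w≈ = place-Any′ sorted (ℕ.suc-injective eq) w∈
        in resp (trans (place-tail hs vs (λ i≡h → All.lookup (≢-head lts) i∈ (≡.sym i≡h))) w≈) (p i))
      where
      place-Any′ : ∀ {n} {hs : List (Fin n)} {vs w} → Sorted hs → length hs ≡ length vs →
                   w ∈ vs → ∃ λ i → i ∈ hs × place hs vs i ≈ w
      place-Any′ {hs = h ∷ hs} {v ∷ vs} (lts ∷ _) eq (here ≡.refl) =
        h , here ≡.refl , place-head vs lts
      place-Any′ {hs = h ∷ hs} {v ∷ vs} (lts ∷ sorted) eq (there w∈)
        with place-Any′ sorted (ℕ.suc-injective eq) w∈
      ... | i , i∈ , eq′ =
        i , there i∈ , trans (place-tail hs vs (λ i≡h → All.lookup (≢-head lts) i∈ (≡.sym i≡h))) eq′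

  Unit-resp : ∀ {x y} → x ≈ y → Unit x → Unit y
  Unit-resp x≈y (0≤x , x≤1) = ≤-respʳ x≈y 0≤x , ≤-respˡ x≈y x≤1

  Unit-0 : Unit 0#
  Unit-0 = ≤-refl , 0≤1

  place-PS : ∀ {n} {Y : Pred (Vector ℝ n) 0ℓ} {hs vs} → Y (place hs vs) → Sorted hs →
             length hs ≡ length vs → All Unit vs → Any (_≈ 1#) vs → PS Y (place hs vs)
  place-PS {Y = Y} yx sorted eq units one with place-Any (λ x≈y → trans (sym x≈y)) sorted eq one
  ... | i , _ , pi = unit-PS {Y = Y} yx (place-All Unit-resp Unit-0 sorted units) (i , pi)

  record Near (d x y : ℝ) : Set where
    constructor near
    field
      upper : x ≤ d + y
      lower : y ≤ d + x

  Near-resp : ∀ {d x x′ y y′} → x ≈ x′ → y ≈ y′ → Near d x y → Near d x′ y′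
  Near-resp x≈ y≈ (near u l) =
    near (≤-respˡ x≈ (≤-respʳ (+-congˡ y≈) u)) (≤-respˡ y≈ (≤-respʳ (+-congˡ x≈) l))

  module _ {d : ℝ} (0≤d : 0# ≤ d) {HasLevel : ℝ → ℕ → Set} {value : ℕ → ℝ} {R : ℕ}
    (near-0 : ∀ {v a} → R ℕ.≤ a → HasLevel v a → Near d v 0#)
    (near-value : ∀ {v a b} → Close R a b → HasLevel v a → Near d v (value b)) where

    -- A skipped letter leaves its position out of `js`, where the copy of the target is then 0;
    -- `near-0` covers this case, and `near-value` the matched letters.
    place-match : ∀ {n as bs} {hs : List (Fin n)} {vs} → Match R as bs → Pointwise HasLevel vs as →
      Sorted hs → length hs ≡ length vs → ∃ λ js → js ⊆ hs × length js ≡ length bs ×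
      (∀ i → Near d (place hs vs i) (place js (List.map value bs) i))
    place-match {hs = []} [] [] _ _ =
      [] , [] , ≡.refl , λ i → near (≤-respʳ (sym (+-identityʳ d)) 0≤d) (≤-respʳ (sym (+-identityʳ d)) 0≤d)
    place-match {hs = h ∷ hs} {v ∷ vs} (skip R≤a m) (lv ∷ p) (lts ∷ sorted) eq
      with place-match m p sorted (ℕ.suc-injective eq)
    ... | js , js⊆ , len , close = js , h ∷ʳ js⊆ , len , close′
      where
      close′ : ∀ i → Near d (place (h ∷ hs) (v ∷ vs) i) _
      close′ i with em {i ≡ h}
      ... | yes ≡.refl = Near-resp (sym (place-head vs lts))
        (sym (place-outside _ (≢-head (All-resp-⊆ js⊆ lts)))) (near-0 R≤a lv)
      ... | no i≢h = Near-resp (sym (place-tail hs vs i≢h)) refl (close i)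
    place-match {hs = h ∷ hs} {v ∷ vs} (take {b = b} {bs = bs} c m) (lv ∷ p) (lts ∷ sorted) eq
      with place-match m p sorted (ℕ.suc-injective eq)
    ... | js , js⊆ , len , close = h ∷ js , ≡.refl ∷ js⊆ , ≡.cong suc len , close′
      where
      close′ : ∀ i → Near d (place (h ∷ hs) (v ∷ vs) i) (place (h ∷ js) (value b ∷ List.map value bs) i)
      close′ i with em {i ≡ h}
      ... | yes ≡.refl = Near-resp (sym (place-head vs lts))
        (sym (place-head (List.map value bs) (All-resp-⊆ js⊆ lts))) (near-value c lv)
      ... | no i≢h = Near-resp (sym (place-tail hs vs i≢h)) (sym (place-tail js (List.map value bs) i≢h)) (close i)

  Near⇒‖‖≤ : ∀ {n d} {x y : Vector ℝ n} → 0# ≤ d → (∀ i → Near d (x i) (y i)) → ‖ x ⊖ y ‖ ≤ d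
  Near⇒‖‖≤ {x = x} {y} 0≤d close =
    ‖‖-lub (x ⊖ y) 0≤d (λ i → ∣x-y∣≤z (Near.upper (close i)) (Near.lower (close i)))

  maximum : ∀ {n} (A : Pred (Fin n) 0ℓ) → ∃ A → ∃ (IsMax A)
  maximum {suc n} A (i , ai) with em {∃ (A ∘ Fin.suc)}
  ... | yes ne with maximum (A ∘ Fin.suc) ne
  ...   | k , ak , max = Fin.suc k , ak , λ { Fin.zero _ → z≤n ; (Fin.suc j) aj → s≤s (max j aj) }
  maximum {suc n} A (Fin.suc i , ai) | no empty = ⊥-elim (empty (i , ai))
  maximum {suc n} A (Fin.zero , a0)  | no empty =
    Fin.zero , a0 , λ { Fin.zero _ → z≤n ; (Fin.suc j) aj → ⊥-elim (empty (j , aj)) }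

  minimum : ∀ {n} (A : Pred (Fin n) 0ℓ) → ∃ A → ∃ (IsMin A)
  minimum {suc n} A (i , ai) with em {A Fin.zero}
  ... | yes a0 = Fin.zero , a0 , λ _ _ → z≤n
  minimum {suc n} A (Fin.zero , a0)  | no ¬a0 = ⊥-elim (¬a0 a0)
  minimum {suc n} A (Fin.suc i , ai) | no ¬a0 with minimum (A ∘ Fin.suc) (i , ai)
  ... | k , ak , min = Fin.suc k , ak ,
    λ { Fin.zero a0 → ⊥-elim (¬a0 a0) ; (Fin.suc j) aj → s≤s (min j aj) }

  -- Block sequences made of copies of one profile.

  module BlockVectors (profile : List ℝ) (units : All Unit profile) (one : Any (_≈ 1#) profile) where

    width : ℕ
    width = length profile

    blockVectors : ∀ {n} m → List (Fin n) → Vector (Vector ℝ n) m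
    blockVectors (suc m) hs Fin.zero    = place (List.take width hs) profile
    blockVectors (suc m) hs (Fin.suc i) = blockVectors m (List.drop width hs) i

    coordinates : ∀ {m} → Vector ℝ m → List ℝ
    coordinates {zero}  c = []
    coordinates {suc m} c = List.map (c Fin.zero *_) profile ++ coordinates (c ∘ Fin.suc)

    length-take-width : ∀ {n} m (hs : List (Fin n)) → length hs ≡ suc m ℕ.* width →
                        length (List.take width hs) ≡ width
    length-take-width m hs eq = ≡.trans (List.length-take width hs)
      (ℕ.m≤n⇒m⊓n≡m (≡.subst (width ℕ.≤_) (≡.sym eq) (ℕ.m≤m+n width (m ℕ.* width))))

    length-drop-width : ∀ {n} m (hs : List (Fin n)) → length hs ≡ suc m ℕ.* width →
                        length (List.drop width hs) ≡ m ℕ.* width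
    length-drop-width m hs eq = ≡.trans (List.length-drop width hs)
      (≡.trans (≡.cong (ℕ._∸ width) eq) (ℕ.m+n∸m≡n width (m ℕ.* width)))

    length-coordinates : ∀ {m} (c : Vector ℝ m) → length (coordinates c) ≡ m ℕ.* width
    length-coordinates {zero}  c = ≡.refl
    length-coordinates {suc m} c = ≡.trans (List.length-++ (List.map (c Fin.zero *_) profile))
      (≡.cong₂ ℕ._+_ (List.length-map (c Fin.zero *_) profile) (length-coordinates (c ∘ Fin.suc)))

    -- As `place` is a sum, concatenating positions and values adds the vectors. Thus a vector of
    -- the span is described by one list of values on `hs`.
    combination : ∀ {n m} (hs : List (Fin n)) (c : Vector ℝ m) → length hs ≡ m ℕ.* width → ∀ j →
                  sum (λ i → c i * blockVectors m hs i j) ≈ place hs (coordinates c) j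
    combination {m = zero}  []       c eq j = refl
    combination {m = zero}  (_ ∷ _)  c () j
    combination {m = suc m} hs c eq j = begin-equality
      c Fin.zero * place us profile j + sum (λ i → c (Fin.suc i) * blockVectors m vs i j)
        ≈⟨ +-cong (place-scale (c Fin.zero) us profile j)
                  (combination vs (c ∘ Fin.suc) (length-drop-width m hs eq) j) ⟩
      place us (List.map (c Fin.zero *_) profile) j + place vs (coordinates (c ∘ Fin.suc)) j
        ≈⟨ place-++ us (List.map (c Fin.zero *_) profile) (≡.trans (length-take-width m hs eq)
                                  (≡.sym (List.length-map (c Fin.zero *_) profile))) j ⟩
      place (us ++ vs) (coordinates c) j
        ≡⟨ ≡.cong (λ ks → place ks (coordinates c) j) (List.take++drop≡id width hs) ⟩
      place hs (coordinates c) j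
        ∎
      where
      us = List.take width hs
      vs = List.drop width hs

    span : ∀ {n m} (hs : List (Fin n)) → length hs ≡ m ℕ.* width → ∀ {x} →
           Span (blockVectors m hs) x → ∃ λ c → ∀ j → x j ≈ place hs (coordinates c) j
    span hs eq (c , x≈) = c , λ j → trans (x≈ j) (combination hs c eq j)

    blockVectors-PS : ∀ {n m} {Y : Pred (Vector ℝ n) 0ℓ} (hs : List (Fin n)) → Sorted hs →
      length hs ≡ m ℕ.* width → ∀ i → Y (blockVectors m hs i) → PS Y (blockVectors m hs i)
    blockVectors-PS {m = suc m} {Y} hs sorted eq Fin.zero yx =
      place-PS {Y = Y} yx (AllPairs.take⁺ width sorted) (length-take-width m hs eq) units one
    blockVectors-PS {m = suc m} {Y} hs sorted eq (Fin.suc i) yx =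
      blockVectors-PS {m = m} {Y} (List.drop width hs) (AllPairs.drop⁺ width sorted)
        (length-drop-width m hs eq) i yx

    blockVectors-one : ∀ {n m} (hs : List (Fin n)) → Sorted hs →
      length hs ≡ m ℕ.* width → ∀ i → ∃ λ j → blockVectors m hs i j ≈ 1#
    blockVectors-one {m = suc m} hs sorted eq Fin.zero
      with place-Any (λ x≈y → trans (sym x≈y)) (AllPairs.take⁺ width sorted) (length-take-width m hs eq) one
    ... | j , _ , eq′ = j , eq′
    blockVectors-one {m = suc m} hs sorted eq (Fin.suc i) =
      blockVectors-one {m = m} (List.drop width hs) (AllPairs.drop⁺ width sorted)
        (length-drop-width m hs eq) i

    blockVectors-support : ∀ {n} m (hs : List (Fin n)) i {j} →
      supp (blockVectors m hs i) j → j ∈ hs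
    blockVectors-support (suc m) hs Fin.zero j∈ =
      ∈-take width hs (place-support _ profile j∈)
      where
      ∈-take : ∀ k (hs : List _) {j} → j ∈ List.take k hs → j ∈ hs
      ∈-take (suc k) (h ∷ hs) (here eq)  = here eq
      ∈-take (suc k) (h ∷ hs) (there j∈) = there (∈-take k hs j∈)
    blockVectors-support (suc m) hs (Fin.suc i) j∈ =
      ∈-drop width hs (blockVectors-support m (List.drop width hs) i j∈)
      where
      ∈-drop : ∀ k (hs : List _) {j} → j ∈ List.drop k hs → j ∈ hs
      ∈-drop zero    hs       j∈ = j∈
      ∈-drop (suc k) (h ∷ hs) j∈ = there (∈-drop k hs j∈)

    take<drop : ∀ {n} k {hs : List (Fin n)} → Sorted hs → ∀ {a b} →
                a ∈ List.take k hs → b ∈ List.drop k hs → a Fin.< b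
    take<drop (suc k) {h ∷ hs} (lts ∷ sorted) (here ≡.refl) b∈ =
      All.lookup (All.drop⁺ k lts) b∈
    take<drop (suc k) {h ∷ hs} (lts ∷ sorted) (there a∈)    b∈ = take<drop k sorted a∈ b∈

    supports-< : ∀ {n} m (hs : List (Fin n)) → Sorted hs → ∀ {i j} → i Fin.< j → ∀ {a b} →
      supp (blockVectors m hs i) a → supp (blockVectors m hs j) b → a Fin.< b
    supports-< (suc m) hs sorted {Fin.zero} {Fin.suc j} _ a∈ b∈ =
      take<drop width sorted (place-support _ profile a∈)
                (blockVectors-support m (List.drop width hs) j b∈)
    supports-< (suc m) hs sorted {Fin.suc i} {Fin.suc j} (s≤s i<j) a∈ b∈ =
      supports-< m (List.drop width hs) (AllPairs.drop⁺ width sorted) i<j a∈ b∈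

    isPositiveBlockSequence : ∀ {n m} (hs : List (Fin n)) → Sorted hs →
      length hs ≡ m ℕ.* width → IsPositiveBlockSequence (blockVectors m hs)
    isPositiveBlockSequence {m = m} hs sorted eq = record
      { nonzero  = λ i zeros → let j , j∈ = nonempty i in j∈ (zeros j)
      ; positive = λ i → proj₁ (proj₂ (blockVectors-PS {m = m} {Y = λ _ → ⊤} hs sorted eq i tt))
      ; block    = λ i j i<j →
          let a , max = maximum _ (nonempty i)
              b , min = minimum _ (nonempty j)
          in a , b , max , min , supports-< m hs sorted i<j (proj₁ max) (proj₁ min)
      }
      where
      nonempty : ∀ i → ∃ (supp (blockVectors m hs i))
      nonempty i with blockVectors-one {m = m} hs sorted eq i
      ... | j , ≈1 = j , λ ≈0 → 0≉1 (trans (sym ≈0) ≈1)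

    -- Completeness yields suprema of nonempty sets only, so the oscillation requires a point of the
    -- sphere; the first block vector is one.
    span-nonempty : ∀ {n m} (hs : List (Fin n)) → Sorted hs → length hs ≡ suc m ℕ.* width →
                    ∃ (PS (Span (blockVectors (suc m) hs)))
    span-nonempty {m = m} hs sorted eq =
      y Fin.zero , blockVectors-PS {m = suc m} {Y = Span y} hs sorted eq Fin.zero (e₀ , e₀-spans)
      where
      y = blockVectors (suc m) hs
      e₀ : Vector ℝ (suc m)
      e₀ Fin.zero    = 1#
      e₀ (Fin.suc _) = 0#
      sum-zero : ∀ {k} (z : Vector ℝ k) → sum (λ i → 0# * z i) ≈ 0#
      sum-zero {zero}  z = refl
      sum-zero {suc k} z = trans (+-cong (zeroˡ _) (sum-zero (z ∘ Fin.suc))) (+-identityˡ 0#)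
      e₀-spans : ∀ j → y Fin.zero j ≈ sum (λ i → e₀ i * y i j)
      e₀-spans j = sym (trans (+-cong (*-identityˡ _) (sum-zero (λ i → y (Fin.suc i) j)))
                              (+-identityʳ _))

-- Oscillation and the stabilization of Lipschitz functions.

module Stabilization (em : ExcludedMiddle 0ℓ) (R : Reals) where

  open Ramsey
  open Patterns
  open TowerBounds

  open OrderedField em R
  open Vectors em R

  module Oscillation {n : ℕ} (f : ∃ (PS (ℓ∞ n)) → ℝ) where

    small-osc : ∀ {Y : Pred (Vector ℝ n) 0ℓ} {ε B} → ∃ (PS Y) → B < ε →
      (∀ p q → PS Y (proj₁ p) → PS Y (proj₁ q) → ∣ f p - f q ∣ ≤ B) →
      ∃ λ o → IsOsc f (PS Y) o × o < ε
    small-osc {Y} {ε} {B} (x , px) B<ε bound =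
      proj₁ sup , proj₂ sup , (begin-strict
        proj₁ sup  ≤⟨ proj₂ (proj₂ sup) B bounded ⟩
        B          <⟨ B<ε ⟩
        ε          ∎)
      where
      differences : Pred ℝ 0ℓ
      differences r = ∃₂ λ p q → PS Y (proj₁ p) × PS Y (proj₁ q) × r ≈ ∣ f p - f q ∣
      p : ∃ (PS (ℓ∞ n))
      p = x , tt , proj₂ px
      bounded : UpperBound differences B
      bounded r (p , q , pp , pq , r≈) = ≤-respˡ (sym r≈) (bound p q pp pq)
      sup : ∃ (IsSup differences)
      sup = complete differences (_ , p , p , px , px , refl) (B , bounded)

  -- The block sequence is the standard basis. This settles the cases outside the tower estimates: a
  -- single vector, or a single colour.
  stabilizes-trivially : ∀ {C ε d} m → 0# ≤ C → C * d < ε →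
    (∀ {x y : Vector ℝ (suc m)} → PS (ℓ∞ _) x → PS (ℓ∞ _) y → ‖ x ⊖ y ‖ ≤ d) →
    Stabilizes C ε (suc m) (suc m)
  stabilizes-trivially {C} {ε} {d} m 0≤C Cd<ε close f lip =
    blockVectors (suc m) hs , isPositiveBlockSequence hs sorted len ,
    small-osc (span-nonempty hs sorted len) Cd<ε (λ p q _ _ →
      ≤-trans (lip p q) (*-monoˡ-≤ C 0≤C (close (proj₂ p) (proj₂ q))))
    where
    open Oscillation f
    open BlockVectors (1# ∷ []) ((0≤1 , ≤-refl) ∷ []) (here refl)
    hs = List.allFin (suc m)
    sorted : Sorted hs
    sorted = allFin-sorted (suc m)
    len : length hs ≡ suc m ℕ.* width
    len = ≡.trans (List.length-tabulate {n = suc m} (λ i → i)) (≡.sym (ℕ.*-identityʳ (suc m)))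

  one-dimensional : ∀ {x y : Vector ℝ 1} → PS (ℓ∞ 1) x → PS (ℓ∞ 1) y → ‖ x ⊖ y ‖ ≤ 0#
  one-dimensional {x} {y} px py = ‖‖-lub (x ⊖ y) ≤-refl λ { Fin.zero →
    ∣x-y∣≤z (≤-respʳ (sym (+-identityˡ _)) (compare px py))
            (≤-respʳ (sym (+-identityˡ _)) (compare py px)) }
    where
    compare : ∀ {x y : Vector ℝ 1} → PS (ℓ∞ 1) x → PS (ℓ∞ 1) y → x Fin.zero ≤ y Fin.zero
    compare {x} {y} px (_ , 0≤y , norm) = begin
      x Fin.zero   ≤⟨ proj₂ (PS-unit {Y = ℓ∞ 1} px Fin.zero) ⟩
      1#           ≈⟨ norm ⟨
      ‖ y ‖        ≤⟨ ‖‖-lub y (0≤y Fin.zero) (λ { Fin.zero → ∣x∣≤y ≤-refl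
                      (≤-trans (≤-respʳ -0#≈0# (-‿anti-≤ (0≤y Fin.zero))) (0≤y Fin.zero)) }) ⟩
      y Fin.zero   ∎

  InCell : ℝ → ℝ → ℕ → Set
  InCell w g i = fromℕ i * w ≤ g × g ≤ fromℕ (suc i) * w

  cell : ∀ c {w g} → 0# ≤ g → g ≤ fromℕ (suc c) * w → ∃ λ (i : Fin (suc c)) → InCell w g (Fin.toℕ i)
  cell zero {w} 0≤g g≤ = Fin.zero , ≤-respˡ (sym (zeroˡ w)) 0≤g , g≤
  cell (suc c) {w} {g} 0≤g g≤ with total g (fromℕ (suc c) * w)
  ... | inj₂ ≤g = Fin.fromℕ (suc c) ,
    ≡.subst (InCell w g) (≡.sym (Fin.toℕ-fromℕ (suc c))) (≤g , g≤)
  ... | inj₁ g≤′ with cell c 0≤g g≤′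
  ...   | i , inCell = Fin.inject₁ i , ≡.subst (InCell w g) (≡.sym (Fin.toℕ-inject₁ i)) inCell

  same-cell : ∀ {w g h i} → InCell w g i → InCell w h i → ∣ g - h ∣ ≤ w
  same-cell {w} {i = i} (i≤g , g≤) (i≤h , h≤) = interval (≤-reflexive (begin-equality
    (1# + fromℕ i) * w        ≈⟨ distribʳ w 1# (fromℕ i) ⟩
    1# * w + fromℕ i * w      ≈⟨ +-congʳ (*-identityˡ w) ⟩
    w + fromℕ i * w           ∎)) i≤g g≤ i≤h h≤

  -- Rounding real values to powers of `q`.

  module Levels {δ : ℝ} (0<δ : 0# < δ) (δ<1 : δ < 1#) {r : ℕ} (qʳ≤δ : (1# - δ) ^ r ≤ δ) where

    q d : ℝ
    q = 1# - δ
    d = δ + δ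

    0≤δ : 0# ≤ δ
    0≤δ = <⇒≤ 0<δ

    0≤q : 0# ≤ q
    0≤q = x≤y⇒0≤y-x (<⇒≤ δ<1)

    q≤1 : q ≤ 1#
    q≤1 = x≤z+y⇒x-y≤z (x≤x+y 1# 0≤δ)

    δ+q≈1 : δ + q ≈ 1#
    δ+q≈1 = trans (+-comm δ q) (x-y+y≈x 1# δ)

    q<1 : q < 1#
    q<1 = q≤1 , λ q≈1 → proj₂ 0<δ (begin-equality
      0#          ≈⟨ -‿inverseʳ 1# ⟨
      1# - 1#     ≈⟨ +-cong δ+q≈1 (-‿cong q≈1) ⟨
      δ + q - q   ≈⟨ x+y-y≈x δ q ⟩
      δ           ∎)

    0≤d : 0# ≤ d
    0≤d = ≤-trans 0≤δ (x≤x+y δ 0≤δ)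

    δ≤d : δ ≤ d
    δ≤d = x≤x+y δ 0≤δ

    q^-anti : ∀ {a b} → a ℕ.≤ b → q ^ b ≤ q ^ a
    q^-anti = ^-anti-≤ 0≤q q≤1

    0≤q^ : ∀ a → 0# ≤ q ^ a
    0≤q^ a = ^-nonNeg a 0≤q

    q^-unit : ∀ a → Unit (q ^ a)
    q^-unit a = 0≤q^ a , q^-anti {b = a} z≤n

    q^-step : ∀ a → q ^ a ≤ δ + q ^ suc a
    q^-step a = begin
      q ^ a                     ≈⟨ *-identityˡ (q ^ a) ⟨
      1# * q ^ a                ≈⟨ *-congʳ δ+q≈1 ⟨
      (δ + q) * q ^ a           ≈⟨ distribʳ (q ^ a) δ q ⟩
      δ * q ^ a + q * q ^ a     ≤⟨ +-monoˡ-≤ (q ^ suc a) (*-monoˡ-≤ δ 0≤δ (proj₂ (q^-unit a))) ⟩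
      δ * 1# + q ^ suc a        ≈⟨ +-congʳ (*-identityʳ δ) ⟩
      δ + q ^ suc a             ∎

    q^-step² : ∀ a → q ^ a ≤ d + q ^ (2 ℕ.+ a)
    q^-step² a = begin
      q ^ a                       ≤⟨ q^-step a ⟩
      δ + q ^ suc a               ≤⟨ +-monoʳ-≤ δ (q^-step (suc a)) ⟩
      δ + (δ + q ^ (2 ℕ.+ a))     ≈⟨ +-assoc δ δ _ ⟨
      d + q ^ (2 ℕ.+ a)           ∎

    -- A value up to `q ^ r` has every level from `r` on. With this convention levels simply add in
    -- `HasLevel-scale`, also beyond `r`.
    data HasLevel (v : ℝ) (a : ℕ) : Set where
      exact : a ℕ.< r → q ^ suc a ≤ v → v ≤ q ^ a → HasLevel v a
      tiny  : r ℕ.≤ a → 0# ≤ v → v ≤ q ^ r → HasLevel v a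

    near-0 : ∀ {v a} → r ℕ.≤ a → HasLevel v a → Near d v 0#
    near-0 r≤a (exact a<r _ _) = ⊥-elim (ℕ.<⇒≱ a<r r≤a)
    near-0 {v} _ (tiny _ 0≤v v≤) = near
      (≤-respʳ (sym (+-identityʳ d)) (≤-trans v≤ (≤-trans qʳ≤δ δ≤d)))
      (≤-trans 0≤d (x≤x+y d 0≤v))

    -- The extreme case is `a = suc b`, where `v` may be as small as `q ^ (2 + b)`: one step for the
    -- mismatch of the letters and one for the rounding of `v`. This is why `d` is twice δ.
    near-value : ∀ {v a b} → Close r a b → HasLevel v a → Near d v (q ^ b)
    near-value (deep r≤a _) (exact a<r _ _) = ⊥-elim (ℕ.<⇒≱ a<r r≤a)
    near-value {v} {a} {b} (near a≤ b≤) (exact _ ≤v v≤) = near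
      (begin
        v                      ≤⟨ v≤ ⟩
        q ^ a                  ≤⟨ q^-step² a ⟩
        d + q ^ (2 ℕ.+ a)      ≤⟨ +-monoʳ-≤ d (q^-anti (ℕ.m≤n⇒m≤1+n b≤)) ⟩
        d + q ^ b              ∎)
      (begin
        q ^ b                  ≤⟨ q^-step² b ⟩
        d + q ^ (2 ℕ.+ b)      ≤⟨ +-monoʳ-≤ d (q^-anti (s≤s a≤)) ⟩
        d + q ^ suc a          ≤⟨ +-monoʳ-≤ d ≤v ⟩
        d + v                  ∎)
    near-value {v} {a} {b} c (tiny r≤a 0≤v v≤) = near
      (≤-trans v≤ (≤-trans qʳ≤δ (≤-trans δ≤d (x≤x+y d (0≤q^ b)))))
      (≤-trans (small c) (x≤x+y d 0≤v))
      where
      small : Close r a b → q ^ b ≤ d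
      small (deep _ r≤b)  = ≤-trans (q^-anti r≤b) (≤-trans qʳ≤δ δ≤d)
      small (near a≤ _) = begin
        q ^ b            ≤⟨ q^-step b ⟩
        δ + q ^ suc b    ≤⟨ +-monoʳ-≤ δ (≤-trans (q^-anti (ℕ.≤-trans r≤a a≤)) qʳ≤δ) ⟩
        δ + δ            ∎

    HasLevel-scale : ∀ {c β} a → HasLevel c β → HasLevel (c * q ^ a) (β ℕ.+ a)
    HasLevel-scale {c} {β} a (exact β<r ≤c c≤) with (β ℕ.+ a) ℕ.<? r
    ... | yes lt = exact lt
      (≤-respˡ (sym (^-homo-* q (suc β) a)) (*-monoʳ-≤ (q ^ a) (0≤q^ a) ≤c))
      (≤-respʳ (sym (^-homo-* q β a)) (*-monoʳ-≤ (q ^ a) (0≤q^ a) c≤))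
    ... | no ≮r = tiny (ℕ.≮⇒≥ ≮r) (*-nonNeg (≤-trans (0≤q^ (suc β)) ≤c) (0≤q^ a)) (begin
      c * q ^ a        ≤⟨ *-monoʳ-≤ (q ^ a) (0≤q^ a) c≤ ⟩
      q ^ β * q ^ a    ≈⟨ ^-homo-* q β a ⟨
      q ^ (β ℕ.+ a)    ≤⟨ q^-anti (ℕ.≮⇒≥ ≮r) ⟩
      q ^ r            ∎)
    HasLevel-scale {c} {β} a (tiny r≤β 0≤c c≤) =
      tiny (ℕ.≤-trans r≤β (ℕ.m≤m+n β a)) (*-nonNeg 0≤c (0≤q^ a)) (begin
        c * q ^ a        ≤⟨ *-monoˡ-≤ c 0≤c (proj₂ (q^-unit a)) ⟩
        c * 1#           ≈⟨ *-identityʳ c ⟩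
        c                ≤⟨ c≤ ⟩
        q ^ r            ∎)

    -- Levels overlap at powers of `q`. The last clause settles the choice at `c ≈ q`, so that a
    -- coefficient that is not below `q` always gives a block with shift 0.
    level : ∀ {c} → Unit c → ∃ λ β → HasLevel c β × (q ≤ c → β ≡ 0)
    level {c} (0≤c , c≤1) with em {q ≤ c}
    ... | yes q≤c = 0 , top , λ _ → ≡.refl
      where
      top : HasLevel c 0
      top with 0 ℕ.<? r
      ... | yes 0<r = exact 0<r (≤-respˡ (sym (*-identityʳ q)) q≤c) c≤1
      ... | no  0≮r = tiny (ℕ.≮⇒≥ 0≮r) 0≤c (≤-trans c≤1 (q^-anti (ℕ.≮⇒≥ 0≮r)))
    ... | no q≰c with search r ℕ.≤-refl
      where
      search : ∀ k → k ℕ.≤ r → (∃ λ β → HasLevel c β) ⊎ c ≤ q ^ k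
      search zero    _   = inj₂ c≤1
      search (suc k) k<r with search k (ℕ.<⇒≤ k<r)
      ... | inj₁ found = inj₁ found
      ... | inj₂ c≤ with total (q ^ suc k) c
      ...   | inj₁ ≤c = inj₁ (k , exact k<r ≤c c≤)
      ...   | inj₂ c≤′ = inj₂ c≤′
    ...   | inj₁ (β , hasLevel) = β , hasLevel , λ q≤c → ⊥-elim (q≰c q≤c)
    ...   | inj₂ c≤ = r , tiny ℕ.≤-refl 0≤c c≤ , λ q≤c → ⊥-elim (q≰c q≤c)

    -- Unit vectors of the span are close to copies of the target.

    module Approximation {m p : ℕ} (2m+2≤p : 2 ℕ.* m ℕ.+ 2 ℕ.≤ p) where

      open Words p
      open Blocks r m 2m+2≤p

      values : List ℕ → List ℝ
      values = List.map (q ^_)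

      values-unit : ∀ as → All Unit (values as)
      values-unit as = All.map⁺ (All.universal q^-unit as)

      values-one : ∀ {as} → 0 ∈ as → Any (_≈ 1#) (values as)
      values-one 0∈ = Any.map (λ { ≡.refl → refl }) (∈-map⁺ (q ^_) 0∈)

      0∈block : 0 ∈ block r 0
      0∈block = ∈-++⁺ʳ (edgeˡ (suc r) 0) (here ≡.refl)

      0∈target : 0 ∈ target r 1 0
      0∈target = ∈-++⁺ʳ (target r 0 0) (here ≡.refl)

      open BlockVectors (values (block r 0)) (values-unit (block r 0)) (values-one 0∈block) public

      pattern-values : List ℝ
      pattern-values = values (target r 1 0)

      coordinates-levels : ∀ {k} (c : Vector ℝ k) (β : Fin k → ℕ) → (∀ i → HasLevel (c i) (β i)) →
        Pointwise HasLevel (coordinates c) (blocks (List.tabulate β))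
      coordinates-levels {zero}  c β levels = []
      coordinates-levels {suc k} c β levels = Pointwise.++⁺
        (≡.subst (Pointwise HasLevel (List.map (c Fin.zero *_) (values (block r 0))))
                 (≡.trans (map-block (β Fin.zero) r 0)
                          (≡.cong (block r) (ℕ.+-identityʳ (β Fin.zero))))
                 (scale (block r 0)))
        (coordinates-levels (c ∘ Fin.suc) (β ∘ Fin.suc) (levels ∘ Fin.suc))
        where
        scale : ∀ as → Pointwise HasLevel (List.map (c Fin.zero *_) (values as))
                                          (List.map (β Fin.zero ℕ.+_) as)
        scale []       = []
        scale (a ∷ as) = HasLevel-scale a (levels Fin.zero) ∷ scale as

      -- The profile contains the value `q ^ 0`, so every coefficient is itself one of the
      -- coordinates.
      coordinates-All : ∀ {P : Pred ℝ 0ℓ} → (∀ {x y} → x ≈ y → P x → P y) →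
        ∀ {k} (c : Vector ℝ k) → All P (coordinates c) → ∀ i → P (c i)
      coordinates-All resp {suc k} c ps Fin.zero = resp (*-identityʳ (c Fin.zero))
        (All.lookup (All.++⁻ˡ _ ps) (∈-map⁺ (c Fin.zero *_) (∈-map⁺ (q ^_) 0∈block)))
      coordinates-All resp {suc k} c ps (Fin.suc i) =
        coordinates-All resp (c ∘ Fin.suc) (All.++⁻ʳ (List.map (c Fin.zero *_) (values (block r 0))) ps) i

      coordinates-≤ : ∀ {k b} (c : Vector ℝ k) → (∀ i → Unit (c i)) → (∀ i → c i ≤ b) →
                      All (λ v → 0# ≤ v × v ≤ b) (coordinates c)
      coordinates-≤ {zero}  c units le = []
      coordinates-≤ {suc k} {b} c units le = All.++⁺
        (All.map⁺ (All.map⁺ (All.universal (λ a →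
          *-nonNeg (proj₁ (units Fin.zero)) (0≤q^ a) , (begin
            c Fin.zero * q ^ a   ≤⟨ *-monoˡ-≤ (c Fin.zero) (proj₁ (units Fin.zero)) (proj₂ (q^-unit a)) ⟩
            c Fin.zero * 1#      ≈⟨ *-identityʳ (c Fin.zero) ⟩
            c Fin.zero           ≤⟨ le Fin.zero ⟩
            b                    ∎)) (block r 0))))
        (coordinates-≤ (c ∘ Fin.suc) (units ∘ Fin.suc) (le ∘ Fin.suc))

      module _ {n} (hs : List (Fin n)) (sorted : Sorted hs) (len : length hs ≡ m ℕ.* width)
        {x : Vector ℝ n} (px : PS (Span (blockVectors m hs)) x) where

        scalars : Vector ℝ m
        scalars = proj₁ (span hs len (proj₁ px))

        x≈ : ∀ j → x j ≈ place hs (coordinates scalars) j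
        x≈ = proj₂ (span hs len (proj₁ px))

        length-hs : length hs ≡ length (coordinates scalars)
        length-hs = ≡.trans len (≡.sym (length-coordinates scalars))

        scalars-unit : ∀ i → Unit (scalars i)
        scalars-unit = coordinates-All Unit-resp scalars (place-All⁻ Unit-resp sorted length-hs
          (λ j → Unit-resp (x≈ j) (PS-unit {Y = Span (blockVectors m hs)} px j)))

        β : Fin m → ℕ
        β i = proj₁ (level (scalars-unit i))

        -- If all coefficients were at most `q`, so would be the norm, which is 1.
        0∈β : 0 ∈ List.tabulate β
        0∈β with em {∃ λ i → q ≤ scalars i}
        ... | yes (i , q≤cᵢ) =
          ≡.subst (_∈ List.tabulate β) (proj₂ (proj₂ (level (scalars-unit i))) q≤cᵢ) (∈-tabulate⁺ i)
        ... | no none-large = ⊥-elim (<⇒≱ q<1 (≤-respˡ (proj₂ (proj₂ px)) (‖‖-lub x 0≤q small)))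
          where
          scalars≤q : ∀ i → scalars i ≤ q
          scalars≤q i with total (scalars i) q
          ... | inj₁ le = le
          ... | inj₂ q≤ = ⊥-elim (none-large (i , q≤))
          small : ∀ j → ∣ x j ∣ ≤ q
          small j = ∣x∣≤y (≤-respˡ (sym (x≈ j)) (proj₂ (placed j)))
            (≤-trans (≤-respʳ -0#≈0# (-‿anti-≤ (proj₁ (proj₂ px) j))) 0≤q)
            where
            placed : ∀ j → 0# ≤ place hs (coordinates scalars) j × place hs (coordinates scalars) j ≤ q
            placed = place-All (λ v≈w (0≤v , v≤q) → ≤-respʳ v≈w 0≤v , ≤-respˡ v≈w v≤q) (≤-refl , 0≤q)
                               sorted (coordinates-≤ scalars scalars-unit scalars≤q)

        approximation : ∃ λ js → js ⊆ hs × length js ≡ length (target r 1 0) ×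
                        ‖ x ⊖ place js pattern-values ‖ ≤ d
        approximation
          with place-match 0≤d {value = q ^_} near-0 near-value
                 (blocks-match (ℕ.≤-reflexive (List.length-tabulate β)) 0∈β
                   (ℕ.≤-trans (s≤s z≤n) (ℕ.≤-trans (ℕ.m≤n+m 2 (2 ℕ.* m)) 2m+2≤p)))
                 (coordinates-levels scalars β (λ i → proj₁ (proj₂ (level (scalars-unit i)))))
                 sorted length-hs
        ... | js , js⊆ , len′ , close = js , js⊆ , len′ ,
          Near⇒‖‖≤ 0≤d (λ j → Near-resp (sym (x≈ j)) refl (close j))

    -- The colouring by values of `f` and its homogeneous sets.

    module _ {C w : ℝ} (0≤C : 0# ≤ C) {m p c n : ℕ} (2m+2≤p : 2 ℕ.* suc m ℕ.+ 2 ℕ.≤ p)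
      (2C≤ : C + C ≤ fromℕ (suc c) * w)
      (large : ramseyBound (length (Words.target p r 1 0)) (suc c)
                           (suc m ℕ.* length (Words.block p r 0)) ℕ.≤ suc n) where

      open Approximation {suc m} {p} 2m+2≤p
      open Words p using (target; block; word-levels)

      module Colouring (f : ∃ (PS (ℓ∞ (suc n))) → ℝ) (lip : Lipschitz C f) where

        Sphere : Set
        Sphere = ∃ (PS (ℓ∞ (suc n)))

        lip-≤ : ∀ (p q : Sphere) {b} → ‖ proj₁ p ⊖ proj₁ q ‖ ≤ b → ∣ f p - f q ∣ ≤ C * b
        lip-≤ p q le = ≤-trans (lip p q) (*-monoˡ-≤ C 0≤C le)

        origin : Sphere
        origin = place (Fin.zero ∷ []) (1# ∷ []) ,
          place-PS {Y = ℓ∞ _} {hs = Fin.zero ∷ []} tt ([] ∷ []) ≡.refl ((0≤1 , ≤-refl) ∷ []) (here refl)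

        -- The positive sphere has diameter at most 1, so `f` differs by at most `C` from its value
        -- at `origin`, and `g` takes values between 0 and `2C`.
        g : Sphere → ℝ
        g p = C + (f p - f origin)

        variation : ∀ p → ∣ f p - f origin ∣ ≤ C
        variation p = ≤-respʳ (*-identityʳ C)
          (lip-≤ p origin (PS-diameter {Y = ℓ∞ _} {ℓ∞ _} (proj₂ p) (proj₂ origin)))

        0≤g : ∀ p → 0# ≤ g p
        0≤g p = x-y≤z⇒x≤z+y (≤-respˡ (sym (+-identityˡ _)) (≤-trans (-x≤∣x∣ _) (variation p)))

        g≤ : ∀ p → g p ≤ fromℕ (suc c) * w
        g≤ p = ≤-trans (+-monoʳ-≤ C (≤-trans (x≤∣x∣ _) (variation p))) 2C≤

        same-cell-≤ : ∀ p q {i} → InCell w (g p) i → InCell w (g q) i → f p ≤ w + f q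
        same-cell-≤ p q {i} cp cq = +-cancelʳ-≤ (C - f origin) (begin
          f p + (C - f origin)        ≈⟨ solve 3 (λ a k z → a :+ (k :+ z) := k :+ (a :+ z)) refl (f p) C (- f origin) ⟩
          g p                         ≤⟨ ∣x-y∣≤z⇒x≤z+y (same-cell {i = i} cp cq) ⟩
          w + g q                     ≈⟨ solve 4 (λ v b k z → v :+ (k :+ (b :+ z)) := v :+ b :+ (k :+ z)) refl w (f q) C (- f origin) ⟩
          w + f q + (C - f origin)    ∎)

        colour : List (Fin (suc n)) → Fin (suc c)
        colour js with em {PS (ℓ∞ _) (place js pattern-values)}
        ... | yes px = proj₁ (cell c (0≤g (_ , px)) (g≤ (_ , px)))
        -- A default for placements off the sphere. Increasing lists as long as the target, to which
        -- homogeneity is applied, never fall under it.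
        ... | no  _  = Fin.zero

        -- `f` takes the membership proof as an argument, and the proof that `em` supplies may
        -- differ from the given one; hence the cell is asserted for some proof only.
        colour-cell : ∀ js → PS (ℓ∞ _) (place js pattern-values) →
          ∃ λ px → InCell w (g (place js pattern-values , px)) (Fin.toℕ (colour js))
        colour-cell js px with em {PS (ℓ∞ _) (place js pattern-values)}
        ... | yes px′ = px′ , proj₂ (cell c (0≤g (_ , px′)) (g≤ (_ , px′)))
        ... | no ¬px  = ⊥-elim (¬px px)

        module Homogenized {ys : List (Fin (suc n))} (ys⊆ : ys ⊆ List.allFin (suc n))
          (large-ys : suc m ℕ.* length (block r 0) ℕ.≤ length ys) {shade : Fin (suc c)}
          (mono : ∀ {js} → js ⊆ ys → length js ≡ length (target r 1 0) → colour js ≡ shade) where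

          hs : List (Fin (suc n))
          hs = List.take (suc m ℕ.* width) ys

          hs⊆ys : hs ⊆ ys
          hs⊆ys = take-⊆ (suc m ℕ.* width) ys

          len : length hs ≡ suc m ℕ.* width
          len = ≡.trans (List.length-take _ ys) (ℕ.m≤n⇒m⊓n≡m
            (≡.subst (λ k → suc m ℕ.* k ℕ.≤ length ys) (≡.sym (List.length-map (q ^_) (block r 0)))
                     large-ys))

          sorted : Sorted hs
          sorted = Sorted-⊆ (⊆-trans hs⊆ys ys⊆) (allFin-sorted (suc n))

          y : Vector (Vector ℝ (suc n)) (suc m)
          y = blockVectors (suc m) hs

          pattern-PS : ∀ {js} → js ⊆ hs → length js ≡ length (target r 1 0) →
                       PS (ℓ∞ _) (place js pattern-values)
          pattern-PS {js} js⊆ len′ = place-PS {Y = ℓ∞ _} {hs = js} tt (Sorted-⊆ js⊆ sorted)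
            (≡.trans len′ (≡.sym (List.length-map (q ^_) (target r 1 0))))
            (values-unit (target r 1 0)) (values-one 0∈target)

          pattern-cell : ∀ {js} → js ⊆ hs → length js ≡ length (target r 1 0) →
            ∃ λ px → InCell w (g (place js pattern-values , px)) (Fin.toℕ shade)
          pattern-cell {js} js⊆ len′ =
            ≡.subst (λ i → ∃ λ px → InCell w (g (place js pattern-values , px)) (Fin.toℕ i))
                    (mono (⊆-trans js⊆ hs⊆ys) len′) (colour-cell js (pattern-PS js⊆ len′))

          Nearby : Sphere → Set
          Nearby p = ∃ λ (p′ : Sphere) → ∣ f p - f p′ ∣ ≤ C * d × InCell w (g p′) (Fin.toℕ shade)

          nearby-pattern : ∀ (p : Sphere) →
            (∃ λ js → js ⊆ hs × length js ≡ length (target r 1 0) ×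
                      ‖ proj₁ p ⊖ place js pattern-values ‖ ≤ d) → Nearby p
          nearby-pattern p (js , js⊆ , len′ , close) with pattern-cell js⊆ len′
          ... | px , inCell =
            (place js pattern-values , px) , lip-≤ p (place js pattern-values , px) close , inCell

          nearby : ∀ (p : Sphere) → PS (Span y) (proj₁ p) → Nearby p
          nearby p pp = nearby-pattern p (approximation hs sorted len pp)

          bound-nearby : ∀ p q → Nearby p → Nearby q → f p ≤ C * d + (w + C * d) + f q
          bound-nearby p q (p′ , p~ , cp) (q′ , q~ , cq) = begin
            f p                              ≤⟨ ∣x-y∣≤z⇒x≤z+y p~ ⟩
            C * d + f p′                     ≤⟨ +-monoʳ-≤ (C * d) (same-cell-≤ p′ q′ {Fin.toℕ shade} cp cq) ⟩
            C * d + (w + f q′)               ≤⟨ +-monoʳ-≤ (C * d) (+-monoʳ-≤ w (∣x-y∣≤z⇒y≤z+x q~)) ⟩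
            C * d + (w + (C * d + f q))      ≈⟨ solve 3 (λ e v b → e :+ (v :+ (e :+ b)) := e :+ (v :+ e) :+ b) refl (C * d) w (f q) ⟩
            C * d + (w + C * d) + f q        ∎

          bound : ∀ p q → PS (Span y) (proj₁ p) → PS (Span y) (proj₁ q) →
                  ∣ f p - f q ∣ ≤ C * d + (w + C * d)
          bound p q pp pq = ∣x-y∣≤z (bound-nearby p q (nearby p pp) (nearby q pq))
                                    (bound-nearby q p (nearby q pq) (nearby p pp))

          stable : ∀ {ε} → C * d + (w + C * d) < ε →
            ∃ λ (y : Vector (Vector ℝ (suc n)) (suc m)) → IsPositiveBlockSequence y ×
            (∃ λ o → IsOsc f (PS (Span y)) o × o < ε)
          stable small = y , isPositiveBlockSequence hs sorted len ,
            Oscillation.small-osc f (span-nonempty hs sorted len) small bound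

      stabilizes : ∀ {ε} → C * d + (w + C * d) < ε → Stabilizes C ε (suc m) (suc n)
      stabilizes {ε} small f lip = conclude (ramsey (length (target r 1 0)) _ colour
        (List.allFin (suc n))
        (ℕ.≤-trans large (ℕ.≤-reflexive (≡.sym (List.length-tabulate {n = suc n} (λ i → i))))))
        where
        open Colouring f lip
        conclude : (∃ λ ys → ys ⊆ List.allFin (suc n) × suc m ℕ.* length (block r 0) ℕ.≤ length ys ×
                    Homogeneous (length (target r 1 0)) colour ys) →
          ∃ λ (y : Vector (Vector ℝ (suc n)) (suc m)) → IsPositiveBlockSequence y ×
          (∃ λ o → IsOsc f (PS (Span y)) o × o < ε)
        conclude (ys , ys⊆ , large-ys , shade , mono) = Homogenized.stable ys⊆ large-ys mono small

  -- Minimality and the numerical constants.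

  least : ∀ {P : Pred ℕ 0ℓ} k → P k → ∃ λ n → Minimal P n × n ℕ.≤ k
  least {P} k pk with search k
    where
    search : ∀ k → (∃ λ n → Minimal P n × n ℕ.≤ k) ⊎ (∀ j → P j → k ℕ.< j)
    search zero with em {P 0}
    ... | yes p0 = inj₁ (0 , (p0 , λ _ _ → z≤n) , z≤n)
    ... | no ¬p0 = inj₂ λ { zero p0 → ⊥-elim (¬p0 p0) ; (suc j) _ → s≤s z≤n }
    search (suc k) with search k
    ... | inj₁ (n , min , n≤k) = inj₁ (n , min , ℕ.m≤n⇒m≤1+n n≤k)
    ... | inj₂ above with em {P (suc k)}
    ...   | yes pk = inj₁ (suc k , (pk , above) , ℕ.≤-refl)
    ...   | no ¬pk = inj₂ λ j pj → ℕ.≤∧≢⇒< (above j pj) λ { ≡.refl → ¬pk pj }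
  ... | inj₁ found = found
  ... | inj₂ above = ⊥-elim (ℕ.<-irrefl ≡.refl (above k pk))

  module Constants {C ε : ℝ} (0<C : 0# < C) (0<ε : 0# < ε) (ε<12C : ε < fromℕ 12 * C) {c : ℕ}
    (9C≤ : fromℕ 9 * C ÷ ε ≤ fromℕ c) where

    fromℕ≈ : ∀ n → fromℕ n ≈ n ·′ 1#
    fromℕ≈ n = ×ᵤ≈× n 1#

    0<12C : 0# < fromℕ 12 * C
    0<12C = *-pos (fromℕ-pos 11) 0<C

    -- Cells of width `w = 2ε/9` cover the range `2C` of `g` as soon as their number is at least
    -- `2C/w = 9C/ε`, which is where `c` comes from.
    δ w : ℝ
    δ = ε ÷ (fromℕ 12 * C)
    w = (ε + ε) ÷ fromℕ 9

    12Cδ≈ε : fromℕ 12 * C * δ ≈ ε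
    12Cδ≈ε = x*[y÷x]≈y ε 0<12C

    9w≈2ε : fromℕ 9 * w ≈ ε + ε
    9w≈2ε = x*[y÷x]≈y (ε + ε) (fromℕ-pos 8)

    0<δ : 0# < δ
    0<δ = ÷-pos 0<12C 0<ε

    δ<1 : δ < 1#
    δ<1 = *-cancelˡ-< 0<12C (begin-strict
      fromℕ 12 * C * δ    ≈⟨ 12Cδ≈ε ⟩
      ε                   <⟨ ε<12C ⟩
      fromℕ 12 * C        ≈⟨ *-identityʳ _ ⟨
      fromℕ 12 * C * 1#   ∎)

    9C≤cε : fromℕ 9 * C ≤ fromℕ c * ε
    9C≤cε = begin
      fromℕ 9 * C               ≈⟨ x*[y÷x]≈y (fromℕ 9 * C) 0<ε ⟨
      ε * (fromℕ 9 * C ÷ ε)     ≤⟨ *-monoˡ-≤ ε (<⇒≤ 0<ε) 9C≤ ⟩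
      ε * fromℕ c               ≈⟨ *-comm ε (fromℕ c) ⟩
      fromℕ c * ε               ∎

    2C≤cw : C + C ≤ fromℕ c * w
    2C≤cw = *-cancelˡ-≤ (fromℕ-pos 8) (begin
      fromℕ 9 * (C + C)             ≈⟨ distribˡ (fromℕ 9) C C ⟩
      fromℕ 9 * C + fromℕ 9 * C     ≤⟨ +-mono-≤ 9C≤cε 9C≤cε ⟩
      fromℕ c * ε + fromℕ c * ε     ≈⟨ distribˡ (fromℕ c) ε ε ⟨
      fromℕ c * (ε + ε)             ≈⟨ *-congˡ 9w≈2ε ⟨
      fromℕ c * (fromℕ 9 * w)       ≈⟨ solve 3 (λ k n v → k :* (n :* v) := n :* (k :* v)) refl (fromℕ c) (fromℕ 9) w ⟩
      fromℕ 9 * (fromℕ c * w)       ∎)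

    -- The sum is `4Cδ + w = ε/3 + 2ε/9 = 10ε/18`; multiplying by 18 clears the denominators.
    error<ε : C * (δ + δ) + (w + C * (δ + δ)) < ε
    error<ε = *-cancelˡ-< (fromℕ-pos 17) (begin-strict
      fromℕ 18 * (C * (δ + δ) + (w + C * (δ + δ)))
        ≈⟨ *-congʳ (fromℕ≈ 18) ⟩
      (18 ·′ 1#) * (C * (δ + δ) + (w + C * (δ + δ)))
        ≈⟨ solve 3 (λ k e v → con 18 :* (k :* (e :+ e) :+ (v :+ k :* (e :+ e)))
                         := con 6 :* (con 12 :* k :* e) :+ con 2 :* (con 9 :* v)) refl C δ w ⟩
      (6 ·′ 1#) * ((12 ·′ 1#) * C * δ) + (2 ·′ 1#) * ((9 ·′ 1#) * w)
        ≈⟨ +-cong (*-congˡ (*-congʳ (*-congʳ (fromℕ≈ 12)))) (*-congˡ (*-congʳ (fromℕ≈ 9))) ⟨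
      (6 ·′ 1#) * (fromℕ 12 * C * δ) + (2 ·′ 1#) * (fromℕ 9 * w)
        ≈⟨ +-cong (*-congˡ 12Cδ≈ε) (*-congˡ 9w≈2ε) ⟩
      (6 ·′ 1#) * ε + (2 ·′ 1#) * (ε + ε)
        ≈⟨ solve 1 (λ e → con 6 :* e :+ con 2 :* (e :+ e) := con 10 :* e) refl ε ⟩
      (10 ·′ 1#) * ε
        ≈⟨ *-congʳ (fromℕ≈ 10) ⟨
      fromℕ 10 * ε
        <⟨ 10ε<18ε ⟩
      fromℕ 18 * ε
        ∎)
      where
      10ε<18ε : fromℕ 10 * ε < fromℕ 18 * ε
      10ε<18ε = begin-strict
        fromℕ 10 * ε          ≈⟨ +-identityˡ _ ⟨
        0# + fromℕ 10 * ε     <⟨ +-monoˡ-< (fromℕ 10 * ε) (*-pos (fromℕ-pos 7) 0<ε) ⟩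
        fromℕ 8 * ε + fromℕ 10 * ε ≈⟨ distribʳ ε (fromℕ 8) (fromℕ 10) ⟨
        (fromℕ 8 + fromℕ 10) * ε   ≈⟨ *-congʳ (×-homo-+ 1# 8 10) ⟨
        fromℕ 18 * ε          ∎

    0<1-δ : 0# < 1# - δ
    0<1-δ = begin-strict
      0#       ≈⟨ -‿inverseʳ δ ⟨
      δ - δ    <⟨ +-monoˡ-< (- δ) δ<1 ⟩
      1# - δ   ∎

    1-δ<1 : 1# - δ < 1#
    1-δ<1 = begin-strict
      1# - δ       ≈⟨ +-identityˡ _ ⟨
      0# + (1# - δ) <⟨ +-monoˡ-< (1# - δ) 0<δ ⟩
      δ + (1# - δ)  ≈⟨ trans (+-comm δ (1# - δ)) (x-y+y≈x 1# δ) ⟩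
      1#           ∎

    1≤c : 1 ℕ.≤ c
    1≤c = positive c 9C≤cε
      where
      positive : ∀ k → fromℕ 9 * C ≤ fromℕ k * ε → 1 ℕ.≤ k
      positive (suc _) _  = s≤s z≤n
      positive zero    le = ⊥-elim (<⇒≱ (*-pos (fromℕ-pos 8) 0<C) (≤-respʳ (zeroˡ ε) le))

    -- A ceiling of 1 means `9C ≤ ε`, so `f` varies by less than ε on the whole sphere.
    C<ε : c ≡ 1 → C * 1# < ε
    C<ε c≡1 = *-cancelˡ-< (fromℕ-pos 8) (begin-strict
      fromℕ 9 * (C * 1#)       ≈⟨ *-congˡ (*-identityʳ C) ⟩
      fromℕ 9 * C              ≤⟨ ≡.subst (λ k → fromℕ 9 * C ≤ fromℕ k * ε) c≡1 9C≤cε ⟩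
      fromℕ 1 * ε              ≈⟨ +-identityˡ _ ⟨
      0# + fromℕ 1 * ε         <⟨ +-monoˡ-< (fromℕ 1 * ε) (*-pos (fromℕ-pos 7) 0<ε) ⟩
      fromℕ 8 * ε + fromℕ 1 * ε  ≈⟨ distribʳ ε (fromℕ 8) (fromℕ 1) ⟨
      (fromℕ 8 + fromℕ 1) * ε    ≈⟨ *-congʳ (×-homo-+ 1# 8 1) ⟨
      fromℕ 9 * ε              ∎)

    StabilizesBelow : ℕ → ℕ → Set
    StabilizesBelow m b = ∃ λ n → Stabilizes C ε m n × n ℕ.< b

    large-case : ∀ {m r l c′} → c ≡ suc c′ → (1# - δ) ^ r ≤ δ →
      3 ℕ.≤ suc m → 1 ℕ.≤ r → 2 ℕ.≤ suc c′ → 1 ℕ.≤ l →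
      StabilizesBelow (suc m) (f₃ (suc m ℕ.^ (r ℕ.+ 2) ℕ.* suc c′ ℕ.^ (suc m ℕ.^ (r ℕ.+ 2)) ℕ.* l))
    large-case {m} {r} {l} {c′} c≡ qʳ≤δ 3≤m 1≤r 2≤c 1≤l =
      -- The dimension `f₃ h` is written as a successor because the colouring needs a base point on
      -- the sphere.
      suc (ℕ.pred (f₃ h)) ,
      Levels.stabilizes 0<δ δ<1 {r} qʳ≤δ (<⇒≤ 0<C) {m} {p} {c′} 2m+2≤p
        (≡.subst (λ k → C + C ≤ fromℕ k * w) c≡ 2C≤cw)
        (ℕ.≤-trans (ramseyBound-≤ L (suc m ℕ.* K) 2≤c) (ℕ.≤-reflexive (≡.sym suc-pred-f₃))) error<ε ,
      ≡.subst (ℕ._< f₃ X) (≡.sym suc-pred-f₃) (f₃-mono-< (size-< r 3≤m 1≤r 2≤c 1≤l K≤ L≤))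
      where
      -- With this choice the powers of `suc p` that measure blocks and target are powers of two,
      -- and their exponents are what `exponent-≤` compares.
      p = ℕ.pred (2 ℕ.^ (suc m ℕ.+ 1))
      1+p : suc p ≡ 2 ℕ.^ (suc m ℕ.+ 1)
      1+p = ℕ.suc-pred _ {{ℕ.m^n≢0 2 (suc m ℕ.+ 1)}}
      open Words p
      2m+2≤p : 2 ℕ.* suc m ℕ.+ 2 ℕ.≤ p
      2m+2≤p = ℕ.s≤s⁻¹ (ℕ.≤-trans (ℕ.≤-reflexive (≡.sym (ℕ.+-suc (2 ℕ.* suc m) 2)))
        (ℕ.≤-trans (3≤m⇒2m+3≤2^[1+m] 3≤m) (ℕ.≤-reflexive (≡.sym 1+p))))
      K = length (block r 0)
      L = length (target r 1 0)
      X = suc m ℕ.^ (r ℕ.+ 2) ℕ.* suc c′ ℕ.^ (suc m ℕ.^ (r ℕ.+ 2)) ℕ.* l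
      h = 3 ℕ.* L ℕ.+ (suc m ℕ.* K ℕ.+ (suc c′ ℕ.+ 3))
      suc-pred-f₃ : suc (ℕ.pred (f₃ h)) ≡ f₃ h
      suc-pred-f₃ = ℕ.suc-pred (f₃ h) {{ℕ.>-nonZero (ℕ.≤-trans (s≤s z≤n) (n<f₃n h))}}
      K≤ : K ℕ.≤ (2 ℕ.^ (suc m ℕ.+ 1)) ℕ.^ (4 ℕ.+ r)
      K≤ = ≡.subst (λ P → K ℕ.≤ P ℕ.^ (4 ℕ.+ r)) 1+p
        (ℕ.<⇒≤ (1+length-block (ℕ.≤-trans (s≤s z≤n) (ℕ.≤-trans (ℕ.m≤n+m 2 (2 ℕ.* suc m)) 2m+2≤p)) r 0))
      L≤ : L ℕ.≤ 2 ℕ.* (2 ℕ.^ (suc m ℕ.+ 1)) ℕ.^ r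
      L≤ = ≡.subst (λ P → L ℕ.≤ 2 ℕ.* P ℕ.^ r) 1+p
        (ℕ.≤-trans (ℕ.n≤1+n L) (ℕ.≤-reflexive (1+length-target r)))

    small-case : ∀ {m r l} → 1 ℕ.≤ l → m ≡ 0 ⊎ c ≡ 1 →
      StabilizesBelow (suc m) (f₃ (suc m ℕ.^ (r ℕ.+ 2) ℕ.* c ℕ.^ (suc m ℕ.^ (r ℕ.+ 2)) ℕ.* l))
    small-case {m} {r} {l} 1≤l trivial =
      suc m , stable trivial , ℕ.<-≤-trans (n<f₃n (suc m)) (f₃-mono-≤ (ℕ.≤⇒≤′ m≤))
      where
      N = suc m ℕ.^ (r ℕ.+ 2)
      m≤ : suc m ℕ.≤ N ℕ.* c ℕ.^ N ℕ.* l
      m≤ = ℕ.≤-trans (ℕ.≤-reflexive (≡.sym (ℕ.*-identityʳ (suc m))))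
        (ℕ.≤-trans (ℕ.^-monoʳ-≤ (suc m) (ℕ.≤-trans (s≤s z≤n) (ℕ.m≤n+m 2 r)))
        (ℕ.≤-trans (ℕ.m≤m*n N (c ℕ.^ N) {{ℕ.m^n≢0 c N {{ℕ.>-nonZero 1≤c}}}})
                   (ℕ.m≤m*n (N ℕ.* c ℕ.^ N) l {{ℕ.>-nonZero 1≤l}})))
      stable : m ≡ 0 ⊎ c ≡ 1 → Stabilizes C ε (suc m) (suc m)
      stable (inj₁ ≡.refl) = stabilizes-trivially 0 (<⇒≤ 0<C)
        (begin-strict
          C * 0#  ≈⟨ zeroʳ C ⟩
          0#      <⟨ 0<ε ⟩
          ε       ∎) one-dimensional
      stable (inj₂ c≡1) = stabilizes-trivially m (<⇒≤ 0<C) (C<ε c≡1)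
        (λ px py → PS-diameter {Y = ℓ∞ _} {ℓ∞ _} px py)

mainTheorem3 : ExcludedMiddle 0ℓ →
    (R : Reals) →
    let open Reals R in
    (log : ℝ → ℝ) → IsLogarithm log →
    (C ε : ℝ) → 0# < C → 0# < ε →
    ε < fromℕ 12 * C → ε < fromℕ 9 →
    (t : ℕ) →
    let δ = ε ÷ (fromℕ 12 * C) in
    (c l r : ℕ) →
    ⌈ fromℕ 9 * C ÷ ε ⌉≡ c →
    ⌈ log (fromℕ 9 ÷ ε) ÷ log (fromℕ 2) ⌉≡ l →
    ⌈ log δ ÷ log (1# - δ) ⌉≡ r →
    let s = r ℕ.+ 2 in
    ∃ λ n → Minimal (Stabilizes C ε (3 ℕ.^ t)) n
    × n ℕ.< f₃ (3 ℕ.^ (t ℕ.* s) ℕ.* c ℕ.^ (3 ℕ.^ (t ℕ.* s)) ℕ.* l)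
mainTheorem3 em R log isLog C ε 0<C 0<ε ε<12C ε<9 t c l r (9C≤ , _) (log≤l , _) (log≤r , _) =
  minimal (≡.subst (λ N → StabilizesBelow (3 ℕ.^ t) (f₃ (N ℕ.* c ℕ.^ N ℕ.* l)))
                   (ℕ.^-*-assoc 3 t (r ℕ.+ 2)) (below t))
  where
  open OrderedField em R
  open Logarithm isLog
  open Stabilization em R
  open Constants 0<C 0<ε ε<12C {c} 9C≤

  qʳ≤δ : (1# - δ) ^ r ≤ δ
  qʳ≤δ = ^-≤-of-log r 0<δ 0<1-δ 1-δ<1 log≤r

  1≤r : 1 ℕ.≤ r
  1≤r = positive r qʳ≤δ
    where
    positive : ∀ k → (1# - δ) ^ k ≤ δ → 1 ℕ.≤ k
    positive (suc _) _   = s≤s z≤n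
    positive zero    1≤δ = ⊥-elim (<⇒≱ δ<1 1≤δ)

  1<2 : 1# < fromℕ 2
  1<2 = begin-strict
    1#              ≈⟨ +-identityˡ 1# ⟨
    0# + 1#         <⟨ +-monoˡ-< 1# 0<1 ⟩
    1# + 1#         ≈⟨ +-congˡ (+-identityʳ 1#) ⟨
    fromℕ 2         ∎

  1<9÷ε : 1# < fromℕ 9 ÷ ε
  1<9÷ε = *-cancelˡ-< 0<ε (begin-strict
    ε * 1#              ≈⟨ *-identityʳ ε ⟩
    ε                   <⟨ ε<9 ⟩
    fromℕ 9             ≈⟨ x*[y÷x]≈y (fromℕ 9) 0<ε ⟨
    ε * (fromℕ 9 ÷ ε)   ∎)

  1≤l : 1 ℕ.≤ l
  1≤l = positive l log≤l
    where
    positive : ∀ k → log (fromℕ 9 ÷ ε) ÷ log (fromℕ 2) ≤ fromℕ k → 1 ℕ.≤ k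
    positive (suc _) _  = s≤s z≤n
    positive zero    ≤0 = ⊥-elim (<⇒≱ (log-÷-pos 1<9÷ε 1<2) ≤0)

  -- The tower estimates ask for at least three vectors and two colours; `t = 0` and `c = 1` are
  -- therefore treated by `small-case`.
  below : ∀ t → StabilizesBelow (3 ℕ.^ t)
    (f₃ ((3 ℕ.^ t) ℕ.^ (r ℕ.+ 2) ℕ.* c ℕ.^ ((3 ℕ.^ t) ℕ.^ (r ℕ.+ 2)) ℕ.* l))
  below zero    = small-case {0} {r} 1≤l (inj₁ ≡.refl)
  below (suc t) = ≡.subst
    (λ m → StabilizesBelow m (f₃ (m ℕ.^ (r ℕ.+ 2) ℕ.* c ℕ.^ (m ℕ.^ (r ℕ.+ 2)) ℕ.* l)))
    1+m (cases c ≡.refl)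
    where
    m = ℕ.pred (3 ℕ.^ suc t)
    1+m : suc m ≡ 3 ℕ.^ suc t
    1+m = ℕ.suc-pred _ {{ℕ.m^n≢0 3 (suc t)}}
    3≤1+m : 3 ℕ.≤ suc m
    3≤1+m = ≡.subst (3 ℕ.≤_) (≡.sym 1+m) (ℕ.m≤m*n 3 (3 ℕ.^ t) {{ℕ.m^n≢0 3 t}})
    cases : ∀ c′ → c ≡ c′ →
      StabilizesBelow (suc m) (f₃ (suc m ℕ.^ (r ℕ.+ 2) ℕ.* c ℕ.^ (suc m ℕ.^ (r ℕ.+ 2)) ℕ.* l))
    cases zero          c≡0    = ⊥-elim (ℕ.<⇒≢ 1≤c (≡.sym c≡0))
    cases (suc zero)    c≡1    = small-case {m} {r} 1≤l (inj₂ c≡1)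
    cases (suc (suc c′)) c≡2+c′ =
      ≡.subst (λ c → StabilizesBelow (suc m) (f₃ (suc m ℕ.^ (r ℕ.+ 2) ℕ.* c ℕ.^ (suc m ℕ.^ (r ℕ.+ 2)) ℕ.* l)))
              (≡.sym c≡2+c′)
              (large-case c≡2+c′ qʳ≤δ 3≤1+m 1≤r (s≤s (s≤s z≤n)) 1≤l)

  minimal : ∀ {m b} → StabilizesBelow m b → ∃ λ n → Minimal (Stabilizes C ε m) n × n ℕ.< b
  minimal (n₀ , stable , n₀<b) with least n₀ stable
  ... | n , min , n≤n₀ = n , min , ℕ.≤-<-trans n≤n₀ n₀<b
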